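{- Let $c\in(0,1)$ and $C>0$ be constants, $p=w(n)/n$ with $\log^4n\ll w(n)<cn$, and $k=C\,w(n)^{1/2}$. Let $G\sim G(n,p)$ on vertex set $V=[n]$. For $K\subset V$ with $|K|=k$ and $i\in V\setminus K$ let $X_i$ be the number of neighbors of $i$ in $K$. Then with probability at least $1-\exp(-2k\log n)$, for every choice of $K\subset V$ with $|K|=k$, \[\sum_{i\in V\setminus K}(X_i-kp)^2\le (n-k)kp(1-p)+o(nkp(1-p)),\] where the $o(nkp(1-p))$ term is a function of $n$ only (not depending on $K$).
   Context: $G(n,p)$ is the Erdős–Rényi random graph with edge probability $p$. $f\ll g$ means $f/g\to0$. Logarithms base $2$. -}

module Defs where

open import Algebra.Bundles using (CommutativeRing; Semiring)
import Algebra.Definitions.RawSemiring as RawSemiringDefinitions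
open import Axiom.ExcludedMiddle using (ExcludedMiddle)
open import Data.Bool.Base using (Bool; true; false; if_then_else_)
open import Data.Fin.Base using (Fin; zero; suc)
open import Data.Fin.Subset using (Subset; inside; outside; _∩_; ∣_∣)
open import Data.Fin.Subset.Properties using (_∈?_)
open import Data.List.Base using (List; []; _∷_; _++_; map; foldr; filter; upTo; allFin; cartesianProductWith)
open import Data.Nat.Base as ℕ using (ℕ; _!)
open import Data.Product.Base using (∃; _×_; _,_)
open import Data.Vec.Base as Vec using ([]; _∷_; lookup; tabulate)
open import Level using (0ℓ)
open import Relation.Binary.Core using (Rel)
open import Relation.Binary.PropositionalEquality using (_≡_; refl)
open import Relation.Binary.Structures using (IsTotalOrder)
open import Relation.Nullary using (¬_; does; yes; no)
import Relation.Binary.Construct.NonStrictToStrict as Strict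

-- The real numbers are taken up to isomorphism: a Dedekind-complete ordered
-- field, with equality a setoid relation.  The value of 0# ⁻¹ is unspecified.
record CompleteOrderedField : Set₁ where
  infix 4 _≤_
  infix 8 _⁻¹
  field
    commutativeRing : CommutativeRing 0ℓ 0ℓ
  open CommutativeRing commutativeRing public
  field
    _⁻¹          : Carrier → Carrier
    ⁻¹-cong      : ∀ {x y} → x ≈ y → x ⁻¹ ≈ y ⁻¹
    *-inverseʳ   : ∀ x → ¬ (x ≈ 0#) → x * x ⁻¹ ≈ 1#
    0≉1          : ¬ (0# ≈ 1#)
    _≤_          : Rel Carrier 0ℓ
    isTotalOrder : IsTotalOrder _≈_ _≤_
    +-monoʳ-≤    : ∀ z {x y} → x ≤ y → z + x ≤ z + y
    *-nonneg     : ∀ {x y} → 0# ≤ x → 0# ≤ y → 0# ≤ x * y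

  UpperBound : (Carrier → Set) → Carrier → Set
  UpperBound E b = ∀ x → E x → x ≤ b

  field
    supremum : (E : Carrier → Set) → ∃ E → ∃ (UpperBound E) →
               ∃ λ s → UpperBound E s × (∀ b → UpperBound E b → s ≤ b)

-- A simple graph on Fin n.  In  s ▷ G  the new vertex is zero, the old vertex i
-- becomes suc i, and s is the set of old vertices adjacent to the new one; so
-- each unordered pair of distinct vertices is recorded exactly once.
infixr 5 _▷_
data Graph : ℕ → Set where
  ∅   : Graph 0
  _▷_ : ∀ {n} → Subset n → Graph n → Graph (ℕ.suc n)

adjacent : ∀ {n} → Graph n → Fin n → Fin n → Bool
adjacent (s ▷ G) zero    zero    = false
adjacent (s ▷ G) zero    (suc j) = lookup s j
adjacent (s ▷ G) (suc i) zero    = lookup s i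
adjacent (s ▷ G) (suc i) (suc j) = adjacent G i j

adjacent-irrefl : ∀ {n} (G : Graph n) i → adjacent G i i ≡ false
adjacent-irrefl (s ▷ G) zero    = refl
adjacent-irrefl (s ▷ G) (suc i) = adjacent-irrefl G i

adjacent-sym : ∀ {n} (G : Graph n) i j → adjacent G i j ≡ adjacent G j i
adjacent-sym (s ▷ G) zero    zero    = refl
adjacent-sym (s ▷ G) zero    (suc j) = refl
adjacent-sym (s ▷ G) (suc i) zero    = refl
adjacent-sym (s ▷ G) (suc i) (suc j) = adjacent-sym G i j

neighbours : ∀ {n} → Graph n → Fin n → Subset n
neighbours G i = tabulate (adjacent G i)

subsets : ∀ n → List (Subset n)
subsets ℕ.zero    = [] ∷ []
subsets (ℕ.suc n) = map (inside ∷_) (subsets n) ++ map (outside ∷_) (subsets n)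

graphs : ∀ n → List (Graph n)
graphs ℕ.zero    = ∅ ∷ []
graphs (ℕ.suc n) = cartesianProductWith _▷_ (subsets n) (graphs n)

module Analysis (em : ExcludedMiddle 0ℓ) (R : CompleteOrderedField) where

  open CompleteOrderedField R public renaming (Carrier to ℝ)
  open RawSemiringDefinitions (Semiring.rawSemiring semiring) public
    using (_^_) renaming (_×_ to _×ℝ_)
  open Strict _≈_ _≤_ public using (_<_)

  infixl 7 _/_
  _/_ : ℝ → ℝ → ℝ
  x / y = x * y ⁻¹

  fromℕ : ℕ → ℝ
  fromℕ n = n ×ℝ 1#

  ∑ : ∀ {A : Set} → List A → (A → ℝ) → ℝ
  ∑ xs f = foldr (λ x s → f x + s) 0# xs

  -- |x - y| < ε
  Within : ℝ → ℝ → ℝ → Set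
  Within ε x y = (x - y < ε) × (y - x < ε)

  infix 4 _⟶_ _≪_
  _⟶_ : (ℕ → ℝ) → ℝ → Set
  s ⟶ l = ∀ ε → 0# < ε → ∃ λ N → ∀ n → N ℕ.≤ n → Within ε (s n) l

  -- Also used for  f = o(g).
  _≪_ : (ℕ → ℝ) → (ℕ → ℝ) → Set
  f ≪ g = (λ n → f n / g n) ⟶ 0#

  -- Description operator, with value 0# when nothing satisfies P.
  the : (ℝ → Set) → ℝ
  the P with em {∃ P}
  ... | yes (x , _) = x
  ... | no  _       = 0#

  lim : (ℕ → ℝ) → ℝ
  lim s = the (s ⟶_)

  exp : ℝ → ℝ
  exp x = lim λ m → ∑ (upTo m) λ j → x ^ j / fromℕ (j !)

  ln : ℝ → ℝ
  ln x = the λ y → exp y ≈ x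

  log₂ : ℝ → ℝ
  log₂ x = ln x / ln (fromℕ 2)

  √ : ℝ → ℝ
  √ x = the λ y → (0# ≤ y) × (y * y ≈ x)

  -- The distribution G(n,p): each pair is an edge with probability p,
  -- independently of the others.
  rowMass : ∀ {n} → ℝ → Subset n → ℝ
  rowMass p = Vec.foldr _ (λ b m → (if b then p else 1# - p) * m) 1#

  mass : ∀ {n} → ℝ → Graph n → ℝ
  mass p ∅       = 1#
  mass p (s ▷ G) = rowMass p s * mass p G

  Pr : ∀ n → ℝ → (Graph n → Set) → ℝ
  Pr n p A = ∑ (graphs n) λ G → if does (em {A G}) then mass p G else 0#

  X : ∀ {n} → Graph n → Subset n → Fin n → ℕ
  X G K i = ∣ neighbours G i ∩ K ∣

  ∑∈ : ∀ {n} → Subset n → (Fin n → ℝ) → ℝ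
  ∑∈ {n} S f = ∑ (filter (_∈? S) (allFin n)) f

{-# OPTIONS --safe #-}

-- Chernoff's method is applied to Y = ∑_{i ∉ K} (X_i - kp)².  Revealing the
-- edges at K one vertex at a time, a partial deviation t of some X_i changes by
-- z = b - p with b a Bernoulli(p) bit; since z has mean 0 and variance p(1-p),
-- e^u ≤ 1 + u + 2u² gives, for small λ|t|,
--   𝔼 e^{λ(t+z)²} ≤ e^{λ(1+16λp(1-p))t² + λ(1+4λ)p(1-p)}.
-- With λ = a/√w the factors accumulated over k steps stay 1 + O(a), so that
--   𝔼 e^{λY} ≤ e^{λ(1+O(a))(n-k)kp(1-p)}.
-- For an excess δnkp(1-p) and a of order δ, Markov's inequality
-- gains e^{-Ω(aδk√w)}, which beats the union bound n^k and the required
-- e^{-2k log n} because √w ≫ log² n.  As δ is arbitrary, the error term can be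
-- taken to be the least admissible one, up to 1/n.
module Submission where

open import Defs
open import Algebra.Bundles using (RawRing)
import Algebra.Properties.Ring as RingProperties
import Algebra.Properties.Semiring.Exp as SemiringExp
import Algebra.Properties.Semiring.Mult as SemiringMult
import Algebra.Solver.Ring as RingSolver
open import Algebra.Solver.Ring.AlmostCommutativeRing using (fromCommutativeRing; _-Raw-AlmostCommutative⟶_; Induced-equivalence)
open import Axiom.ExcludedMiddle using (ExcludedMiddle)
open import Data.Bool.Base using (Bool; true; false; not; if_then_else_)
open import Data.Empty using (⊥-elim)
open import Data.Fin.Base using (Fin; zero; suc)
open import Data.Fin.Subset using (Subset; inside; outside; _∩_; ∁; ∣_∣)
open import Data.Fin.Subset.Properties using (_∈?_; ∣p∣≤n)
open import Data.Integer.Base as ℤ using (ℤ; -[1+_]; _⊖_)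
import Data.Integer.Properties as ℤ
open import Data.List.Base as List using (List; []; _∷_; _++_; applyUpTo; cartesianProductWith)
open import Data.Maybe.Base using (just; nothing)
open import Data.Nat.Base as ℕ using (ℕ; zero; suc; _!)
import Data.Nat.Properties as ℕ
open import Data.Product.Base using (∃; _×_; _,_; proj₁; proj₂)
open import Data.Sum.Base using (inj₁; inj₂)
open import Data.Vec.Base using ([]; _∷_; lookup; tabulate)
open import Data.Vec.Properties using (tabulate∘lookup)
open import Function.Base using (_∘_; id)
open import Level using (0ℓ)
open import Relation.Binary.Bundles using (Poset)
open import Relation.Binary.Definitions using (WeaklyDecidable)
open import Relation.Binary.PropositionalEquality as ≡ using (_≡_)
import Relation.Binary.Reasoning.PartialOrder as PartialOrderReasoning
open import Relation.Binary.Structures using (IsTotalOrder)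
open import Relation.Nullary using (¬_; Dec; does; yes; no)
open import Relation.Unary using (Decidable)

-- A graph stores each edge once, in the row of its endpoint of smaller index, so the edges from a
-- vertex i outside K to K lie partly in the row of i and partly in rows of vertices of K. An
-- induction on the graph thus never meets X_i as one binomial variable. Its statement gives every i
-- an offset `t i`, the contribution of the rows of K already read. The exponential estimate needs
-- λ|t| small, so the invariant keeps a bound on all |t i| plus the number of unread vertices of K
-- below a fixed M. Since k is of order √w, M can be taken of that order, and λM is then a constant
-- that shrinks with a. In the growth of the coefficient of t² the factor p(1-p) is simply bounded
-- by 1: over k steps the coefficient still changes only by a factor 1 + O(λk) = 1 + O(a). In the
-- constant term p(1-p) must be kept, because it is the main term. The estimate gives, for each δ,
-- some threshold for n, while one error function is wanted. Taking the least admissible error for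
-- each n avoids selecting thresholds. This infimum need not be attained, hence the extra 1/n, which
-- is negligible because nkp(1-p) is eventually at least 1 - c.

module Proof (em : ExcludedMiddle 0ℓ) (R : CompleteOrderedField) where
  open Analysis em R hiding (zero)
  open SemiringExp semiring using (^-congˡ)

  open IsTotalOrder isTotalOrder using (total; antisym; isPartialOrder; ≤-respˡ-≈; ≤-respʳ-≈)
    renaming (refl to ≤-refl; trans to ≤-trans; reflexive to ≤-reflexive)

  ≤-poset : Poset 0ℓ 0ℓ 0ℓ
  ≤-poset = record { isPartialOrder = isPartialOrder }

  module ≤R = PartialOrderReasoning ≤-poset

  -- Integer literals in the field and the ring solver

  open SemiringMult semiring using (×-homo-+; ×1-homo-*)
  open RingProperties ring using (-‿distribˡ-*; -‿distribʳ-*; -0#≈0#; -‿involutive; -‿+-comm)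

  fromℕ-+ : ∀ m n → fromℕ (m ℕ.+ n) ≈ fromℕ m + fromℕ n
  fromℕ-+ = ×-homo-+ 1#

  fromℕ-* : ∀ m n → fromℕ (m ℕ.* n) ≈ fromℕ m * fromℕ n
  fromℕ-* = ×1-homo-*

  -- The literal 1 is interpreted as 1# itself, not as 1# + 0#.
  fromℤ⁺ : ℕ → ℝ
  fromℤ⁺ 1 = 1#
  fromℤ⁺ n = fromℕ n

  fromℤ : ℤ → ℝ
  fromℤ (ℤ.+ n)  = fromℤ⁺ n
  fromℤ -[1+ n ] = - fromℤ⁺ (suc n)

  fromℤ⁺≈fromℕ : ∀ n → fromℤ⁺ n ≈ fromℕ n
  fromℤ⁺≈fromℕ 0             = refl
  fromℤ⁺≈fromℕ 1             = sym (+-identityʳ 1#)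
  fromℤ⁺≈fromℕ (suc (suc n)) = refl

  -- Done by hand, since the ring solver is only assembled from the homomorphism laws that rest on
  -- this.
  [a+b]-[a+c]≈b-c : ∀ a b c → a + b - (a + c) ≈ b - c
  [a+b]-[a+c]≈b-c a b c = begin-equality
    a + b - (a + c)         ≈⟨ +-congˡ (sym (-‿+-comm a c)) ⟩
    a + b + (- a + - c)     ≈⟨ +-congʳ (+-comm a b) ⟩
    b + a + (- a + - c)     ≈⟨ +-assoc b a _ ⟩
    b + (a + (- a + - c))   ≈⟨ +-congˡ (sym (+-assoc a (- a) (- c))) ⟩
    b + (a - a - c)         ≈⟨ +-congˡ (+-congʳ (-‿inverseʳ a)) ⟩
    b + (0# - c)            ≈⟨ +-congˡ (+-identityˡ (- c)) ⟩
    b - c                   ∎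
    where open ≤R

  fromℤ-⊖ : ∀ m n → fromℤ (m ⊖ n) ≈ fromℕ m - fromℕ n
  fromℤ-⊖ zero    zero    = sym (trans (+-identityˡ (- 0#)) -0#≈0#)
  fromℤ-⊖ zero    (suc n) = trans (-‿cong (fromℤ⁺≈fromℕ (suc n))) (sym (+-identityˡ _))
  fromℤ-⊖ (suc m) zero    = trans (fromℤ⁺≈fromℕ (suc m)) (sym (trans (+-congˡ -0#≈0#) (+-identityʳ _)))
  fromℤ-⊖ (suc m) (suc n) =
    trans (reflexive (≡.cong fromℤ (ℤ.[1+m]⊖[1+n]≡m⊖n m n)))
      (trans (fromℤ-⊖ m n) (sym ([a+b]-[a+c]≈b-c 1# (fromℕ m) (fromℕ n))))

  fromℤ-neg : ∀ i → fromℤ (ℤ.- i) ≈ - fromℤ i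
  fromℤ-neg (ℤ.+ 0)       = sym -0#≈0#
  fromℤ-neg (ℤ.+ (suc n)) = refl
  fromℤ-neg -[1+ n ]      = sym (-‿involutive _)

  fromℤ-+ : ∀ i j → fromℤ (i ℤ.+ j) ≈ fromℤ i + fromℤ j
  fromℤ-+ (ℤ.+ m) (ℤ.+ n) = trans (fromℤ⁺≈fromℕ (m ℕ.+ n))
    (trans (fromℕ-+ m n) (sym (+-cong (fromℤ⁺≈fromℕ m) (fromℤ⁺≈fromℕ n))))
  fromℤ-+ (ℤ.+ m) -[1+ n ] = trans (fromℤ-⊖ m (suc n))
    (sym (+-cong (fromℤ⁺≈fromℕ m) (-‿cong (fromℤ⁺≈fromℕ (suc n)))))
  fromℤ-+ -[1+ m ] (ℤ.+ n) = trans (fromℤ-⊖ n (suc m))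
    (trans (+-comm _ _) (sym (+-cong (-‿cong (fromℤ⁺≈fromℕ (suc m))) (fromℤ⁺≈fromℕ n))))
  fromℤ-+ -[1+ m ] -[1+ n ] = trans (-‿cong
    (trans (reflexive (≡.cong (λ k → fromℕ (suc k)) (≡.sym (ℕ.+-suc m n))))
      (trans (fromℕ-+ (suc m) (suc n))
        (sym (+-cong (fromℤ⁺≈fromℕ (suc m)) (fromℤ⁺≈fromℕ (suc n)))))))
    (sym (-‿+-comm _ _))

  fromℤ-*⁺ : ∀ m n → fromℤ⁺ (m ℕ.* n) ≈ fromℤ⁺ m * fromℤ⁺ n
  fromℤ-*⁺ m n = trans (fromℤ⁺≈fromℕ (m ℕ.* n))
    (trans (fromℕ-* m n) (sym (*-cong (fromℤ⁺≈fromℕ m) (fromℤ⁺≈fromℕ n))))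

  fromℤ-* : ∀ i j → fromℤ (i ℤ.* j) ≈ fromℤ i * fromℤ j
  fromℤ-* (ℤ.+ m) (ℤ.+ n) = trans (reflexive (≡.cong fromℤ (≡.sym (ℤ.pos-* m n)))) (fromℤ-*⁺ m n)
  fromℤ-* (ℤ.+ m) -[1+ n ] = begin-equality
    fromℤ (ℤ.+ m ℤ.* -[1+ n ])        ≡⟨ ≡.cong fromℤ (≡.sym (ℤ.neg-distribʳ-* (ℤ.+ m) (ℤ.+ suc n))) ⟩
    fromℤ (ℤ.- (ℤ.+ m ℤ.* ℤ.+ suc n))   ≈⟨ fromℤ-neg (ℤ.+ m ℤ.* ℤ.+ suc n) ⟩
    - fromℤ (ℤ.+ m ℤ.* ℤ.+ suc n)       ≈⟨ -‿cong (fromℤ-* (ℤ.+ m) (ℤ.+ suc n)) ⟩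
    - (fromℤ⁺ m * fromℤ⁺ (suc n))   ≈⟨ -‿distribʳ-* _ _ ⟩
    fromℤ⁺ m * - fromℤ⁺ (suc n)     ∎
    where open ≤R
  fromℤ-* -[1+ m ] (ℤ.+ n) = begin-equality
    fromℤ (-[1+ m ] ℤ.* ℤ.+ n)        ≡⟨ ≡.cong fromℤ (≡.sym (ℤ.neg-distribˡ-* (ℤ.+ suc m) (ℤ.+ n))) ⟩
    fromℤ (ℤ.- (ℤ.+ suc m ℤ.* ℤ.+ n))   ≈⟨ fromℤ-neg (ℤ.+ suc m ℤ.* ℤ.+ n) ⟩
    - fromℤ (ℤ.+ suc m ℤ.* ℤ.+ n)       ≈⟨ -‿cong (fromℤ-* (ℤ.+ suc m) (ℤ.+ n)) ⟩
    - (fromℤ⁺ (suc m) * fromℤ⁺ n)   ≈⟨ -‿distribˡ-* _ _ ⟩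
    - fromℤ⁺ (suc m) * fromℤ⁺ n     ∎
    where open ≤R
  fromℤ-* -[1+ m ] -[1+ n ] = begin-equality
    fromℤ⁺ (suc m ℕ.* suc n)              ≈⟨ fromℤ-*⁺ (suc m) (suc n) ⟩
    fromℤ⁺ (suc m) * fromℤ⁺ (suc n)       ≈⟨ sym (-‿involutive _) ⟩
    - - (fromℤ⁺ (suc m) * fromℤ⁺ (suc n)) ≈⟨ -‿cong (-‿distribˡ-* _ _) ⟩
    - (- fromℤ⁺ (suc m) * fromℤ⁺ (suc n)) ≈⟨ -‿distribʳ-* _ _ ⟩
    - fromℤ⁺ (suc m) * - fromℤ⁺ (suc n)   ∎
    where open ≤R

  ℤ-rawRing : RawRing 0ℓ 0ℓ
  ℤ-rawRing = record { Carrier = ℤ ; _≈_ = _≡_ ; _+_ = ℤ._+_ ; _*_ = ℤ._*_ ; -_ = ℤ.-_ ; 0# = ℤ.+ 0 ; 1# = ℤ.+ 1 }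

  fromℤ-morphism : ℤ-rawRing -Raw-AlmostCommutative⟶ fromCommutativeRing commutativeRing
  fromℤ-morphism = record
    { ⟦_⟧ = fromℤ ; +-homo = fromℤ-+ ; *-homo = fromℤ-* ; -‿homo = fromℤ-neg ; 0-homo = refl ; 1-homo = refl }

  fromℤ-≟ : WeaklyDecidable (Induced-equivalence fromℤ-morphism)
  fromℤ-≟ i j with i ℤ.≟ j
  ... | yes i≡j = just (reflexive (≡.cong fromℤ i≡j))
  ... | no  _   = nothing

  open RingSolver ℤ-rawRing (fromCommutativeRing commutativeRing) fromℤ-morphism fromℤ-≟
    using (solve; _:+_; _:*_; _:-_; :-_; _:=_; con; Polynomial)

  :0 :1 :2 : ∀ {n} → Polynomial n
  :0 = con (ℤ.+ 0)
  :1 = con (ℤ.+ 1)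
  :2 = con (ℤ.+ 2)

  2# : ℝ
  2# = fromℕ 2

  -- Ordered fields and limits

  ≤-resp₂ : ∀ {x x′ y y′} → x ≈ x′ → y ≈ y′ → x ≤ y → x′ ≤ y′
  ≤-resp₂ p q r = ≤-respʳ-≈ q (≤-respˡ-≈ p r)

  ≤⇒0≤ : ∀ {x y} → x ≤ y → 0# ≤ y - x
  ≤⇒0≤ {x} {y} x≤y = ≤-resp₂
    (solve 1 (λ x → :- x :+ x := :0) refl x)
    (solve 2 (λ x y → :- x :+ y := y :- x) refl x y) (+-monoʳ-≤ (- x) x≤y)

  -- The pattern behind most inequalities below: the difference of the two sides is written as an
  -- expression e that is visibly nonnegative, being built with `_⊕_` and `_⊗_`, and the ring solver
  -- checks the identity.
  diff⇒≤ : ∀ {x y e} → 0# ≤ e → y - x ≈ e → x ≤ y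
  diff⇒≤ {x} {y} {e} 0≤e eq = ≤-resp₂ (+-identityʳ x)
    (solve 2 (λ x y → x :+ (y :- x) := y) refl x y)
    (+-monoʳ-≤ x (≤-respʳ-≈ (sym eq) 0≤e))

  infixl 6 _⊕_
  infixl 7 _⊗_
  _⊕_ : ∀ {x y} → 0# ≤ x → 0# ≤ y → 0# ≤ x + y
  _⊕_ {x} {y} 0≤x 0≤y = ≤-trans 0≤x (≤-respˡ-≈ (+-identityʳ x) (+-monoʳ-≤ x 0≤y))

  _⊗_ : ∀ {x y} → 0# ≤ x → 0# ≤ y → 0# ≤ x * y
  _⊗_ = *-nonneg

  +-mono-≤ : ∀ {x y u v} → x ≤ y → u ≤ v → x + u ≤ y + v
  +-mono-≤ {x} {y} {u} {v} x≤y u≤v = diff⇒≤ (≤⇒0≤ x≤y ⊕ ≤⇒0≤ u≤v)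
    (solve 4 (λ x y u v → y :+ v :- (x :+ u) := y :- x :+ (v :- u)) refl x y u v)

  +-monoˡ-≤ : ∀ z {x y} → x ≤ y → x + z ≤ y + z
  +-monoˡ-≤ z x≤y = +-mono-≤ x≤y ≤-refl

  neg-mono-≤ : ∀ {x y} → x ≤ y → - y ≤ - x
  neg-mono-≤ {x} {y} x≤y = diff⇒≤ (≤⇒0≤ x≤y) (solve 2 (λ x y → :- x :- (:- y) := y :- x) refl x y)

  *-monoˡ-≤ : ∀ {x y z} → 0# ≤ z → x ≤ y → z * x ≤ z * y
  *-monoˡ-≤ {x} {y} {z} 0≤z x≤y = diff⇒≤ (0≤z ⊗ ≤⇒0≤ x≤y)
    (solve 3 (λ x y z → z :* y :- z :* x := z :* (y :- x)) refl x y z)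

  *-mono-≤ : ∀ {x y u v} → 0# ≤ u → 0# ≤ y → x ≤ y → u ≤ v → x * u ≤ y * v
  *-mono-≤ {x} {y} {u} {v} 0≤u 0≤y x≤y u≤v = diff⇒≤ (≤⇒0≤ x≤y ⊗ 0≤u ⊕ 0≤y ⊗ ≤⇒0≤ u≤v)
    (solve 4 (λ x y u v → y :* v :- x :* u := (y :- x) :* u :+ y :* (v :- u)) refl x y u v)

  0≤x² : ∀ x → 0# ≤ x * x
  0≤x² x with total 0# x
  ... | inj₁ 0≤x = 0≤x ⊗ 0≤x
  ... | inj₂ x≤0 = ≤-respʳ-≈ (solve 1 (λ x → (:0 :- x) :* (:0 :- x) := x :* x) refl x)
                     (≤⇒0≤ x≤0 ⊗ ≤⇒0≤ x≤0)

  0≤1 : 0# ≤ 1#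
  0≤1 = ≤-respʳ-≈ (*-identityˡ 1#) (0≤x² 1#)

  0<1 : 0# < 1#
  0<1 = 0≤1 , 0≉1

  ≰⇒> : ∀ {x y} → ¬ (x ≤ y) → y < x
  ≰⇒> {x} {y} x≰y with total x y
  ... | inj₁ x≤y = ⊥-elim (x≰y x≤y)
  ... | inj₂ y≤x = y≤x , λ y≈x → x≰y (≤-reflexive (sym y≈x))

  <⇒≱ : ∀ {x y} → x < y → ¬ (y ≤ x)
  <⇒≱ (x≤y , x≉y) y≤x = x≉y (antisym x≤y y≤x)

  ≮⇒≥ : ∀ {x y} → ¬ (x < y) → y ≤ x
  ≮⇒≥ {x} {y} x≮y with em {y ≤ x}
  ... | yes y≤x = y≤x
  ... | no  y≰x = ⊥-elim (x≮y (≰⇒> y≰x))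

  <-≤-trans : ∀ {x y z} → x < y → y ≤ z → x < z
  <-≤-trans x<y y≤z = ≤-trans (proj₁ x<y) y≤z ,
    λ x≈z → <⇒≱ x<y (≤-respʳ-≈ (sym x≈z) y≤z)

  ≤-<-trans : ∀ {x y z} → x ≤ y → y < z → x < z
  ≤-<-trans x≤y y<z = ≤-trans x≤y (proj₁ y<z) ,
    λ x≈z → <⇒≱ y<z (≤-respˡ-≈ x≈z x≤y)

  diff⇒< : ∀ {x y e} → 0# < e → y - x ≈ e → x < y
  diff⇒< {x} {y} 0<e eq = diff⇒≤ (proj₁ 0<e) eq ,
    λ x≈y → proj₂ 0<e (sym (trans (sym eq) (trans (+-congˡ (-‿cong x≈y)) (-‿inverseʳ y))))

  <⇒0< : ∀ {x y} → x < y → 0# < y - x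
  <⇒0< {x} {y} (x≤y , x≉y) = ≤⇒0≤ x≤y , λ e → x≉y
    (trans (sym (+-identityʳ x)) (trans (+-congˡ e) (solve 2 (λ x y → x :+ (y :- x) := y) refl x y)))

  0<⇒≉0 : ∀ {x} → 0# < x → ¬ (x ≈ 0#)
  0<⇒≉0 0<x x≈0 = proj₂ 0<x (sym x≈0)

  ⁻¹-inverseʳ : ∀ {x} → 0# < x → x * x ⁻¹ ≈ 1#
  ⁻¹-inverseʳ 0<x = *-inverseʳ _ (0<⇒≉0 0<x)

  *-pos : ∀ {x y} → 0# < x → 0# < y → 0# < x * y
  *-pos {x} {y} 0<x 0<y = proj₁ 0<x ⊗ proj₁ 0<y , λ 0≈xy → proj₂ 0<y (begin-equality
    0#               ≈⟨ sym (zeroˡ _) ⟩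
    0# * x ⁻¹        ≈⟨ *-congʳ 0≈xy ⟩
    x * y * x ⁻¹     ≈⟨ solve 3 (λ x y z → x :* y :* z := x :* z :* y) refl x y (x ⁻¹) ⟩
    x * x ⁻¹ * y     ≈⟨ *-congʳ (⁻¹-inverseʳ 0<x) ⟩
    1# * y           ≈⟨ *-identityˡ y ⟩
    y                ∎)
    where open ≤R

  *-cancelˡ-≤ : ∀ {c x y} → 0# < c → c * x ≤ c * y → x ≤ y
  *-cancelˡ-≤ {c} {x} {y} 0<c cx≤cy with em {x ≤ y}
  ... | yes x≤y = x≤y
  ... | no  x≰y = ⊥-elim (<⇒≱ (diff⇒< (*-pos 0<c (<⇒0< (≰⇒> x≰y)))
          (solve 3 (λ x y c → c :* x :- c :* y := c :* (x :- y)) refl x y c)) cx≤cy)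

  ⁻¹-pos : ∀ {x} → 0# < x → 0# < x ⁻¹
  ⁻¹-pos {x} 0<x = *-cancelˡ-≤ 0<x (≤-resp₂ (sym (zeroʳ x)) (sym (⁻¹-inverseʳ 0<x)) 0≤1) ,
    λ 0≈ → 0≉1 (trans (sym (zeroʳ x)) (trans (*-congˡ 0≈) (⁻¹-inverseʳ 0<x)))

  /-pos : ∀ {x y} → 0# < x → 0# < y → 0# < x / y
  /-pos 0<x 0<y = *-pos 0<x (⁻¹-pos 0<y)

  *-/-cancel : ∀ {x y} → 0# < y → y * (x / y) ≈ x
  *-/-cancel {x} {y} 0<y = trans (solve 3 (λ x y z → y :* (x :* z) := y :* z :* x) refl x y (y ⁻¹))
    (trans (*-congʳ (⁻¹-inverseʳ 0<y)) (*-identityˡ x))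

  ≤*⇒/≤ : ∀ {x y z} → 0# < y → x ≤ y * z → x / y ≤ z
  ≤*⇒/≤ 0<y x≤yz = *-cancelˡ-≤ 0<y (≤-respˡ-≈ (sym (*-/-cancel 0<y)) x≤yz)

  *≤⇒≤/ : ∀ {x y z} → 0# < y → y * z ≤ x → z ≤ x / y
  *≤⇒≤/ 0<y yz≤x = *-cancelˡ-≤ 0<y (≤-respʳ-≈ (sym (*-/-cancel 0<y)) yz≤x)

  /≤⇒≤* : ∀ {x y z} → 0# < y → x / y ≤ z → x ≤ y * z
  /≤⇒≤* 0<y p = ≤-respˡ-≈ (*-/-cancel 0<y) (*-monoˡ-≤ (proj₁ 0<y) p)

  *-cancelˡ-≈ : ∀ {c x y} → 0# < c → c * x ≈ c * y → x ≈ y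
  *-cancelˡ-≈ 0<c eq = antisym (*-cancelˡ-≤ 0<c (≤-reflexive eq)) (*-cancelˡ-≤ 0<c (≤-reflexive (sym eq)))

  +-pos : ∀ {x y} → 0# < x → 0# ≤ y → 0# < x + y
  +-pos {x} 0<x 0≤y = <-≤-trans 0<x (≤-respˡ-≈ (+-identityʳ x) (+-monoʳ-≤ x 0≤y))

  0≤fromℕ : ∀ n → 0# ≤ fromℕ n
  0≤fromℕ zero    = ≤-refl
  0≤fromℕ (suc n) = 0≤1 ⊕ 0≤fromℕ n

  0<fromℕ : ∀ n → 0# < fromℕ (suc n)
  0<fromℕ n = +-pos 0<1 (0≤fromℕ n)

  fromℕ-mono-≤ : ∀ {m n} → m ℕ.≤ n → fromℕ m ≤ fromℕ n
  fromℕ-mono-≤ {n = n} ℕ.z≤n = 0≤fromℕ n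
  fromℕ-mono-≤ (ℕ.s≤s m≤n)   = +-monoʳ-≤ 1# (fromℕ-mono-≤ m≤n)

  0<2 : 0# < 2#
  0<2 = 0<fromℕ 1

  ½ : ℝ
  ½ = 2# ⁻¹

  0<½ : 0# < ½
  0<½ = ⁻¹-pos 0<2

  halves : ∀ x → x * ½ + x * ½ ≈ x
  halves x = trans (solve 2 (λ x h → x :* h :+ x :* h := x :* (:2 :* h)) refl x ½)
    (trans (*-congˡ (⁻¹-inverseʳ 0<2)) (*-identityʳ x))

  half-pos : ∀ {x} → 0# < x → 0# < x * ½
  half-pos 0<x = *-pos 0<x 0<½

  half-< : ∀ {x} → 0# < x → x * ½ < x
  half-< {x} 0<x = diff⇒< (half-pos 0<x)
    (trans (+-congʳ (sym (halves x))) (solve 1 (λ y → y :+ y :- y := y) refl (x * ½)))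

  halve-≤ : ∀ {x} → 0# ≤ x + x → 0# ≤ x
  halve-≤ {x} p = *-cancelˡ-≤ 0<2 (≤-resp₂ (sym (zeroʳ _)) (solve 1 (λ x → x :+ x := :2 :* x) refl x) p)

  -- Bd x b says |x| ≤ b.
  Bd : ℝ → ℝ → Set
  Bd x b = (- b ≤ x) × (x ≤ b)

  ∃Bd : ∀ x → ∃ λ b → 0# ≤ b × Bd x b
  ∃Bd x with total 0# x
  ... | inj₁ 0≤x = x , 0≤x , diff⇒≤ (0≤x ⊕ 0≤x) (solve 1 (λ x → x :- (:- x) := x :+ x) refl x) , ≤-refl
  ... | inj₂ x≤0 = - x , ≤-resp₂ refl (+-identityˡ _) 0≤-x , ≤-reflexive (solve 1 (λ x → :- (:- x) := x) refl x) ,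
          diff⇒≤ (0≤-x ⊕ 0≤-x) (solve 1 (λ x → :- x :- x := (:0 :- x) :+ (:0 :- x)) refl x)
    where 0≤-x = ≤⇒0≤ x≤0

  Bd-resp : ∀ {x y b c} → x ≈ y → b ≈ c → Bd x b → Bd y c
  Bd-resp x≈y b≈c (l , u) = ≤-resp₂ (-‿cong b≈c) x≈y l , ≤-resp₂ x≈y b≈c u

  Bd-weaken : ∀ {x b c} → b ≤ c → Bd x b → Bd x c
  Bd-weaken b≤c (l , u) = ≤-trans (neg-mono-≤ b≤c) l , ≤-trans u b≤c

  Bd-+ : ∀ {x y b c} → Bd x b → Bd y c → Bd (x + y) (b + c)
  Bd-+ {b = b} {c} (l , u) (l′ , u′) =
    ≤-respˡ-≈ (solve 2 (λ b c → :- b :+ :- c := :- (b :+ c)) refl b c) (+-mono-≤ l l′) , +-mono-≤ u u′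

  Bd-neg : ∀ {x b} → Bd x b → Bd (- x) b
  Bd-neg {x} {b} (l , u) = neg-mono-≤ u , ≤-respʳ-≈ (solve 1 (λ b → :- (:- b) := b) refl b) (neg-mono-≤ l)

  Bd⁺ : ∀ {x b} → Bd x b → 0# ≤ b + x
  Bd⁺ {x} {b} (l , _) = ≤-respʳ-≈ (solve 2 (λ x b → x :- (:- b) := b :+ x) refl x b) (≤⇒0≤ l)

  Bd⁻ : ∀ {x b} → Bd x b → 0# ≤ b - x
  Bd⁻ (_ , u) = ≤⇒0≤ u

  mkBd : ∀ {x b} → 0# ≤ b + x → 0# ≤ b - x → Bd x b
  mkBd {x} {b} p q = diff⇒≤ p (solve 2 (λ x b → x :- (:- b) := b :+ x) refl x b) , diff⇒≤ q refl

  -- Twice bc + xy is (b - x)(c - y) + (b + x)(c + y), and twice bc - xy is (b - x)(c + y) + (b +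
  -- x)(c - y); all four factors are nonnegative.
  Bd-* : ∀ {x y b c} → Bd x b → Bd y c → Bd (x * y) (b * c)
  Bd-* {x} {y} {b} {c} p q = mkBd
    (halve-≤ (≤-respʳ-≈ (solve 4 (λ x y b c → (b :- x) :* (c :- y) :+ (b :+ x) :* (c :+ y)
        := b :* c :+ x :* y :+ (b :* c :+ x :* y)) refl x y b c)
      (Bd⁻ p ⊗ Bd⁻ q ⊕ Bd⁺ p ⊗ Bd⁺ q)))
    (halve-≤ (≤-respʳ-≈ (solve 4 (λ x y b c → (b :- x) :* (c :+ y) :+ (b :+ x) :* (c :- y)
        := b :* c :- x :* y :+ (b :* c :- x :* y)) refl x y b c)
      (Bd⁻ p ⊗ Bd⁺ q ⊕ Bd⁺ p ⊗ Bd⁻ q)))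

  0≤x⇒Bd : ∀ {x} → 0# ≤ x → Bd x x
  0≤x⇒Bd {x} 0≤x = diff⇒≤ (0≤x ⊕ 0≤x) (solve 1 (λ x → x :- (:- x) := x :+ x) refl x) , ≤-refl

  -- Otherwise the naturals have a supremum s; as n + 1 ≤ s for every n, s - 1 is an upper bound
  -- too, which is absurd.
  archimedean : ∀ x → ∃ λ n → x < fromℕ n
  archimedean x with em {∃ λ n → x < fromℕ n}
  ... | yes p = p
  ... | no ¬p = ⊥-elim (<⇒≱ 0<1 (≤-resp₂ (solve 1 (λ s → s :- s :+ :1 := :1) refl s)
                                   (solve 1 (λ s → s :- :1 :- s :+ :1 := :0) refl s)
                                   (+-monoˡ-≤ 1# (+-monoˡ-≤ (- s) s≤s-1))))
    where
    E : ℝ → Set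
    E y = ∃ λ n → y ≈ fromℕ n
    all≤ : ∀ n → fromℕ n ≤ x
    all≤ n = ≮⇒≥ (λ q → ¬p (n , q))
    bounded : UpperBound E x
    bounded y (n , y≈n) = ≤-respˡ-≈ (sym y≈n) (all≤ n)
    S = supremum E (0# , 0 , refl) (x , bounded)
    s = proj₁ S
    s≤s-1 : s ≤ s - 1#
    s≤s-1 = proj₂ (proj₂ S) (s - 1#) λ y (n , y≈n) →
      diff⇒≤ (≤⇒0≤ (proj₁ (proj₂ S) (fromℕ (suc n)) (suc n , refl)))
        (trans (+-congˡ (-‿cong y≈n)) (solve 2 (λ s n → s :- :1 :- n := s :- (:1 :+ n)) refl s (fromℕ n)))

  ∃⁻¹< : ∀ {ε} → 0# < ε → ∃ λ N → ∀ n → suc N ℕ.≤ n → fromℕ n ⁻¹ ≤ ε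
  ∃⁻¹< {ε} 0<ε with archimedean (ε ⁻¹)
  ... | N , ε⁻¹<N = N , λ { (suc n) (ℕ.s≤s N≤n) → let 0<n = 0<fromℕ n in
          *-cancelˡ-≤ 0<n (*-cancelˡ-≤ (⁻¹-pos 0<ε) (≤-resp₂
            (sym (trans (*-congˡ (⁻¹-inverseʳ 0<n)) (*-identityʳ _)))
            (sym (trans (solve 3 (λ i n e → i :* (n :* e) := e :* i :* n) refl (ε ⁻¹) (fromℕ (suc n)) ε)
                   (trans (*-congʳ (⁻¹-inverseʳ 0<ε)) (*-identityˡ _))))
            (≤-trans (proj₁ ε⁻¹<N) (fromℕ-mono-≤ (ℕ.m≤n⇒m≤1+n N≤n))))) }

  ∃min : ∀ {x y} → 0# < x → 0# < y → ∃ λ z → 0# < z × z ≤ x × z ≤ y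
  ∃min {x} {y} 0<x 0<y with total x y
  ... | inj₁ x≤y = x , 0<x , ≤-refl , x≤y
  ... | inj₂ y≤x = y , 0<y , y≤x , ≤-refl

  ∀ε⇒≤ : ∀ {x y} → (∀ ε → 0# < ε → x ≤ y + ε) → x ≤ y
  ∀ε⇒≤ {x} {y} h with em {x ≤ y}
  ... | yes x≤y = x≤y
  ... | no  x≰y = ⊥-elim (<⇒≱ (half-< 0<d) (diff⇒≤ (≤⇒0≤ (h (d * ½) (half-pos 0<d)))
                    (solve 3 (λ x y h → h :- (x :- y) := y :+ h :- x) refl x y (d * ½))))
    where
    d = x - y
    0<d = <⇒0< (≰⇒> x≰y)

  infix 4 _⇝_
  -- Convergence with non-strict bounds, so that the rules for `Bd` apply. It agrees with `_⟶_`,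
  -- because ε can be halved.
  _⇝_ : (ℕ → ℝ) → ℝ → Set
  s ⇝ l = ∀ ε → 0# < ε → ∃ λ N → ∀ n → N ℕ.≤ n → Bd (s n - l) ε

  ⇝⇒⟶ : ∀ {s l} → s ⇝ l → s ⟶ l
  ⇝⇒⟶ {s} {l} h ε 0<ε with h (ε * ½) (half-pos 0<ε)
  ... | N , bd = N , λ n N≤n → ≤-<-trans (proj₂ (bd n N≤n)) (half-< 0<ε) ,
          ≤-<-trans (≤-respˡ-≈ (solve 2 (λ x y → :- (x :- y) := y :- x) refl (s n) l) (proj₂ (Bd-neg (bd n N≤n))))
            (half-< 0<ε)

  ⟶⇒⇝ : ∀ {s l} → s ⟶ l → s ⇝ l
  ⟶⇒⇝ {s} {l} h ε 0<ε with h ε 0<ε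
  ... | N , f = N , λ n N≤n → mkBd
          (≤-respʳ-≈ (solve 3 (λ e s l → e :- (l :- s) := e :+ (s :- l)) refl ε (s n) l) (≤⇒0≤ (proj₁ (proj₂ (f n N≤n)))))
          (≤⇒0≤ (proj₁ (proj₁ (f n N≤n))))

  ⇝-const : ∀ {s l} → (∀ n → s n ≈ l) → s ⇝ l
  ⇝-const {s} {l} s≈l ε 0<ε = 0 , λ n _ →
    Bd-resp (sym (trans (+-congʳ (s≈l n)) (-‿inverseʳ l))) refl
      (mkBd (≤-respʳ-≈ (sym (+-identityʳ ε)) (proj₁ 0<ε))
            (≤-respʳ-≈ (solve 1 (λ e → e := e :- :0) refl ε) (proj₁ 0<ε)))

  ⇝-cong : ∀ {s t l m} → (∀ n → s n ≈ t n) → l ≈ m → s ⇝ l → t ⇝ m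
  ⇝-cong s≈t l≈m h ε 0<ε with h ε 0<ε
  ... | N , f = N , λ n N≤n → Bd-resp (+-cong (s≈t n) (-‿cong l≈m)) refl (f n N≤n)

  ⇝-+ : ∀ {s t l m} → s ⇝ l → t ⇝ m → (λ n → s n + t n) ⇝ l + m
  ⇝-+ {s} {t} {l} {m} f g ε 0<ε with f (ε * ½) (half-pos 0<ε) | g (ε * ½) (half-pos 0<ε)
  ... | N₁ , f′ | N₂ , g′ = N₁ ℕ.+ N₂ , λ n N≤n →
    Bd-resp (solve 4 (λ s t l m → s :- l :+ (t :- m) := s :+ t :- (l :+ m)) refl (s n) (t n) l m) (halves ε)
      (Bd-+ (f′ n (ℕ.m+n≤o⇒m≤o N₁ N≤n)) (g′ n (ℕ.m+n≤o⇒n≤o N₁ N≤n)))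

  ⇝-neg : ∀ {s l} → s ⇝ l → (λ n → - s n) ⇝ - l
  ⇝-neg {s} {l} f ε 0<ε with f ε 0<ε
  ... | N , f′ = N , λ n N≤n →
    Bd-resp (solve 2 (λ s l → :- (s :- l) := :- s :- (:- l)) refl (s n) l) refl (Bd-neg (f′ n N≤n))

  -- The difference splits as (s - l)(t - m) + l(t - m) + (s - l)m, and η² ≤ η since η ≤ 1.
  *-close : ∀ {s t l m a b η} → 0# ≤ η → η ≤ 1# → Bd l a → Bd m b → Bd (s - l) η → Bd (t - m) η →
            Bd (s * t - l * m) ((1# + a + b) * η)
  *-close {s} {t} {l} {m} {a} {b} {η} 0≤η η≤1 la mb u v = Bd-weaken
    (diff⇒≤ (0≤η ⊗ ≤⇒0≤ η≤1)
      (solve 3 (λ h a b → (:1 :+ a :+ b) :* h :- (h :* h :+ (a :* h :+ h :* b)) := h :* (:1 :- h)) refl η a b))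
    (Bd-resp (solve 4 (λ s t l m → (s :- l) :* (t :- m) :+ (l :* (t :- m) :+ (s :- l) :* m) := s :* t :- l :* m)
        refl s t l m) refl
      (Bd-+ (Bd-* u v) (Bd-+ (Bd-* la v) (Bd-* u mb))))

  ⇝-* : ∀ {s t l m} → s ⇝ l → t ⇝ m → (λ n → s n * t n) ⇝ l * m
  ⇝-* {s} {t} {l} {m} f g ε 0<ε =
    let a , 0≤a , la = ∃Bd l
        b , 0≤b , mb = ∃Bd m
        0<c = +-pos (+-pos 0<1 0≤a) 0≤b
        η , 0<η , η≤1 , η≤ε/c = ∃min 0<1 (/-pos 0<ε 0<c)
        N₁ , f′ = f η 0<η
        N₂ , g′ = g η 0<η
    in N₁ ℕ.+ N₂ , λ n N≤n →
      Bd-weaken (≤-respʳ-≈ (*-/-cancel 0<c) (*-monoˡ-≤ (proj₁ 0<c) η≤ε/c))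
        (*-close (proj₁ 0<η) η≤1 la mb (f′ n (ℕ.m+n≤o⇒m≤o N₁ N≤n)) (g′ n (ℕ.m+n≤o⇒n≤o N₁ N≤n)))

  ⇝-≤ : ∀ {s t l m} → s ⇝ l → t ⇝ m → (∃ λ N → ∀ n → N ℕ.≤ n → s n ≤ t n) → l ≤ m
  ⇝-≤ {s} {t} {l} {m} f g (N₀ , s≤t) = ∀ε⇒≤ λ ε 0<ε → helper ε 0<ε
    where
    helper : ∀ ε → 0# < ε → l ≤ m + ε
    helper ε 0<ε with f (ε * ½) (half-pos 0<ε) | g (ε * ½) (half-pos 0<ε)
    ... | N₁ , f′ | N₂ , g′ =
      diff⇒≤ (Bd⁺ (f′ n n≥N₁) ⊕ Bd⁻ (g′ n n≥N₂) ⊕ ≤⇒0≤ (s≤t n n≥N₀))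
        (trans (+-congʳ (+-congˡ (sym (halves ε))))
          (solve 5 (λ s t l m e → m :+ (e :+ e) :- l := e :+ (s :- l) :+ (e :- (t :- m)) :+ (t :- s))
             refl (s n) (t n) l m (ε * ½)))
      where
      n = N₀ ℕ.+ (N₁ ℕ.+ N₂)
      n≥N₀ : N₀ ℕ.≤ n
      n≥N₀ = ℕ.m≤m+n N₀ _
      n≥N₁ : N₁ ℕ.≤ n
      n≥N₁ = ℕ.≤-trans (ℕ.m≤m+n N₁ N₂) (ℕ.m≤n+m _ N₀)
      n≥N₂ : N₂ ℕ.≤ n
      n≥N₂ = ℕ.≤-trans (ℕ.m≤n+m N₂ N₁) (ℕ.m≤n+m _ N₀)

  ⇝-unique : ∀ {s l m} → s ⇝ l → s ⇝ m → l ≈ m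
  ⇝-unique f g = antisym (⇝-≤ f g (0 , λ _ _ → ≤-refl)) (⇝-≤ g f (0 , λ _ _ → ≤-refl))

  ⇝-double : ∀ {s l} → s ⇝ l → (λ n → s (n ℕ.+ n)) ⇝ l
  ⇝-double f ε 0<ε with f ε 0<ε
  ... | N , f′ = N , λ n N≤n → f′ (n ℕ.+ n) (ℕ.≤-trans N≤n (ℕ.m≤m+n n n))

  -- Existence of a limit keeps the description operator off its default value; whichever limit it
  -- then picks will do.
  lim-⇝ : ∀ {s} → ∃ (s ⇝_) → s ⇝ lim s
  lim-⇝ {s} (l , s⇝l) with em {∃ (s ⟶_)}
  ... | yes (_ , s⟶m) = ⟶⇒⇝ s⟶m
  ... | no  ¬conv      = ⊥-elim (¬conv (l , ⇝⇒⟶ s⇝l))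

  monotone-convergence : ∀ s → (∀ n → s n ≤ s (suc n)) → ∃ (λ b → ∀ n → s n ≤ b) → ∃ (s ⇝_)
  monotone-convergence s incr (b , s≤b) = l , conv
    where
    E : ℝ → Set
    E y = ∃ λ n → y ≈ s n
    S = supremum E (s 0 , 0 , refl) (b , λ y (n , y≈) → ≤-respˡ-≈ (sym y≈) (s≤b n))
    l = proj₁ S
    mono : ∀ {m n} → m ℕ.≤′ n → s m ≤ s n
    mono (ℕ.≤′-reflexive ≡.refl) = ≤-refl
    mono (ℕ.≤′-step p)           = ≤-trans (mono p) (incr _)
    s≤l : ∀ n → s n ≤ l
    s≤l n = proj₁ (proj₂ S) (s n) (n , refl)
    conv : s ⇝ l
    conv ε 0<ε with em {∃ λ N → l - ε ≤ s N}
    ... | yes (N , l-ε≤sN) = N , λ n N≤n →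
          diff⇒≤ (≤⇒0≤ (≤-trans l-ε≤sN (mono (ℕ.≤⇒≤′ N≤n))))
            (solve 3 (λ s l e → s :- l :- (:- e) := s :- (l :- e)) refl (s n) l ε) ,
          diff⇒≤ (≤⇒0≤ (s≤l n) ⊕ proj₁ 0<ε) (solve 3 (λ s l e → e :- (s :- l) := l :- s :+ e) refl (s n) l ε)
    ... | no none = ⊥-elim (<⇒≱ 0<ε (diff⇒≤ (≤⇒0≤ l≤l-ε) (solve 2 (λ l e → :0 :- e := l :- e :- l) refl l ε)))
      where
      l≤l-ε : l ≤ l - ε
      l≤l-ε = proj₂ (proj₂ S) (l - ε) λ y (n , y≈) →
        ≤-respˡ-≈ (sym y≈) (proj₁ (≰⇒> (λ q → none (n , q))))

  -- The exponential series

  psum : (ℕ → ℝ) → ℕ → ℝ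
  psum f zero    = 0#
  psum f (suc m) = f 0 + psum (f ∘ suc) m

  ∑-applyUpTo : ∀ (f : ℕ → ℝ) g m → ∑ (applyUpTo g m) f ≡ psum (f ∘ g) m
  ∑-applyUpTo f g zero    = ≡.refl
  ∑-applyUpTo f g (suc m) = ≡.cong (λ s → f (g 0) + s) (∑-applyUpTo f (g ∘ suc) m)

  psum-snoc : ∀ f m → psum f (suc m) ≈ psum f m + f m
  psum-snoc f zero    = +-comm (f 0) 0#
  psum-snoc f (suc m) = trans (+-congˡ (psum-snoc (f ∘ suc) m)) (sym (+-assoc _ _ _))

  psum-cong : ∀ {f g} → (∀ j → f j ≈ g j) → ∀ m → psum f m ≈ psum g m
  psum-cong f≈g zero    = refl
  psum-cong f≈g (suc m) = +-cong (f≈g 0) (psum-cong (f≈g ∘ suc) m)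

  psum-+ : ∀ f g m → psum (λ j → f j + g j) m ≈ psum f m + psum g m
  psum-+ f g zero    = sym (+-identityʳ 0#)
  psum-+ f g (suc m) = trans (+-congˡ (psum-+ (f ∘ suc) (g ∘ suc) m))
    (solve 4 (λ a b c d → a :+ b :+ (c :+ d) := a :+ c :+ (b :+ d)) refl _ _ _ _)

  psum-step : ∀ {f} → (∀ j → 0# ≤ f j) → ∀ m → psum f m ≤ psum f (suc m)
  psum-step {f} 0≤f m = diff⇒≤ (0≤f m)
    (trans (+-congʳ (psum-snoc f m)) (solve 2 (λ s a → s :+ a :- s := a) refl _ _))

  psum-nonneg : ∀ {f} → (∀ j → 0# ≤ f j) → ∀ m → 0# ≤ psum f m
  psum-nonneg 0≤f zero    = ≤-refl
  psum-nonneg 0≤f (suc m) = 0≤f 0 ⊕ psum-nonneg (0≤f ∘ suc) m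

  psum-mono : ∀ {f} → (∀ j → 0# ≤ f j) → ∀ {m n} → m ℕ.≤ n → psum f m ≤ psum f n
  psum-mono 0≤f {n = n} ℕ.z≤n = psum-nonneg 0≤f n
  psum-mono 0≤f (ℕ.s≤s m≤n)   = +-monoʳ-≤ _ (psum-mono (0≤f ∘ suc) m≤n)

  psum-Bd : ∀ {f g} → (∀ j → Bd (f j) (g j)) → ∀ {m n} → m ℕ.≤ n →
            Bd (psum f n - psum f m) (psum g n - psum g m)
  psum-Bd fg {n = zero}  ℕ.z≤n = Bd-resp (sym (-‿inverseʳ 0#)) (sym (-‿inverseʳ 0#)) (0≤x⇒Bd ≤-refl)
  psum-Bd {f} {g} fg {n = suc n} ℕ.z≤n = Bd-resp (sym (+-assoc _ _ _)) (sym (+-assoc _ _ _))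
    (Bd-+ (fg 0) (psum-Bd (fg ∘ suc) (ℕ.z≤n {n})))
  psum-Bd {f} {g} fg (ℕ.s≤s m≤n) = Bd-resp (lem _ _ _) (lem _ _ _) (psum-Bd (fg ∘ suc) m≤n)
    where
    lem : ∀ a b c → b - c ≈ a + b - (a + c)
    lem = solve 3 (λ a b c → b :- c := a :+ b :- (a :+ c)) refl

  -- Absolute convergence without Cauchy sequences: g + f has nonnegative terms and bounded partial
  -- sums, so it converges by monotonicity, and the limit of g is subtracted.
  psum-dominated : ∀ {f g} → (∀ j → Bd (f j) (g j)) → ∃ (psum g ⇝_) → (∃ λ b → ∀ m → psum g m ≤ b) →
                   ∃ (psum f ⇝_)
  psum-dominated {f} {g} fg (l , g⇝l) (b , g≤b) =
    let h j = g j + f j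
        0≤h : ∀ j → 0# ≤ h j
        0≤h j = Bd⁺ (fg j)
        h≤2b : ∀ m → psum h m ≤ b + b
        h≤2b m = ≤-trans (≤-reflexive (psum-+ g f m)) (+-mono-≤ (g≤b m)
                   (≤-trans (≤-resp₂ (sub0 _) (sub0 _) (proj₂ (psum-Bd fg (ℕ.z≤n {m})))) (g≤b m)))
        l′ , h⇝l′ = monotone-convergence (psum h) (psum-step 0≤h) (b + b , h≤2b)
    in l′ - l , ⇝-cong (λ m → trans (+-congʳ (psum-+ g f m)) (solve 2 (λ x y → x :+ y :- x := y) refl _ _)) refl
                  (⇝-+ h⇝l′ (⇝-neg g⇝l))
    where
    sub0 : ∀ x → x - 0# ≈ x
    sub0 = solve 1 (λ x → x :- :0 := x) refl

  term : ℝ → ℕ → ℝ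
  term x j = x ^ j / fromℕ (j !)

  0<fromℕ! : ∀ j → 0# < fromℕ (j !)
  0<fromℕ! j = <-≤-trans (0<fromℕ 0) (fromℕ-mono-≤ (ℕ.1≤n! j))

  term-zero : ∀ x → term x 0 ≈ 1#
  term-zero x = ⁻¹-unit
    where
    ⁻¹-unit : 1# * fromℕ 1 ⁻¹ ≈ 1#
    ⁻¹-unit = trans (*-congʳ (sym (+-identityʳ 1#))) (⁻¹-inverseʳ (0<fromℕ 0))

  -- The recurrence of the exponential series free of division. In terms of `D` below it is the
  -- differential equation f' = x f.
  term-suc : ∀ x j → fromℕ (suc j) * term x (suc j) ≈ x * term x j
  term-suc x j = *-cancelˡ-≈ (0<fromℕ! j) (begin-equality
    F * (s * (x * y * G ⁻¹))     ≈⟨ solve 5 (λ F s x y g → F :* (s :* (x :* y :* g)) := x :* y :* (s :* F :* g)) refl F s x y (G ⁻¹) ⟩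
    x * y * (s * F * G ⁻¹)       ≈⟨ *-congˡ (*-congʳ (sym (fromℕ-* (suc j) (j !)))) ⟩
    x * y * (G * G ⁻¹)           ≈⟨ *-congˡ (⁻¹-inverseʳ (0<fromℕ! (suc j))) ⟩
    x * y * 1#                   ≈⟨ *-congˡ (sym (⁻¹-inverseʳ (0<fromℕ! j))) ⟩
    x * y * (F * F ⁻¹)           ≈⟨ solve 4 (λ F x y f → x :* y :* (F :* f) := F :* (x :* (y :* f))) refl F x y (F ⁻¹) ⟩
    F * (x * (y * F ⁻¹))         ∎)
    where
    open ≤R
    F = fromℕ (j !)
    G = fromℕ (suc j !)
    s = fromℕ (suc j)
    y = x ^ j

  term-cong : ∀ {x y} → x ≈ y → ∀ j → term x j ≈ term y j
  term-cong x≈y j = *-congʳ (^-congˡ j x≈y)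

  ^-nonneg : ∀ {x} → 0# ≤ x → ∀ j → 0# ≤ x ^ j
  ^-nonneg 0≤x zero    = 0≤1
  ^-nonneg 0≤x (suc j) = 0≤x ⊗ ^-nonneg 0≤x j

  ^-Bd : ∀ {x b} → Bd x b → ∀ j → Bd (x ^ j) (b ^ j)
  ^-Bd xb zero    = 0≤x⇒Bd 0≤1
  ^-Bd xb (suc j) = Bd-* xb (^-Bd xb j)

  term-nonneg : ∀ {x} → 0# ≤ x → ∀ j → 0# ≤ term x j
  term-nonneg 0≤x j = ^-nonneg 0≤x j ⊗ proj₁ (⁻¹-pos (0<fromℕ! j))

  term-Bd : ∀ {x b} → Bd x b → ∀ j → Bd (term x j) (term b j)
  term-Bd xb j = Bd-* (^-Bd xb j) (0≤x⇒Bd (proj₁ (⁻¹-pos (0<fromℕ! j))))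

  -- The ratio of consecutive terms is b / (j + 1), at most one half once j ≥ 2b.
  term-halving : ∀ {b} → 0# ≤ b → ∀ j → b + b ≤ fromℕ j → term b (suc j) + term b (suc j) ≤ term b j
  term-halving {b} 0≤b j 2b≤j = *-cancelˡ-≤ (0<fromℕ j) (≤-respˡ-≈ (begin-equality
      (b + b) * t                            ≈⟨ distribʳ t b b ⟩
      b * t + b * t                          ≈⟨ sym (+-cong (term-suc b j) (term-suc b j)) ⟩
      s * t′ + s * t′                        ≈⟨ sym (distribˡ s t′ t′) ⟩
      s * (t′ + t′)                          ∎)
    (*-mono-≤ (term-nonneg 0≤b j) (0≤fromℕ (suc j))
      (≤-trans 2b≤j (fromℕ-mono-≤ (ℕ.n≤1+n j))) ≤-refl))
    where
    open ≤R
    t  = term b j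
    t′ = term b (suc j)
    s  = fromℕ (suc j)

  -- Once the terms at least halve, psum + 2 · (next term) no longer increases.
  psum-term-bounded : ∀ {b} → 0# ≤ b → ∃ λ B → ∀ m → psum (term b) m ≤ B
  psum-term-bounded {b} 0≤b =
    let N , 2b<N = archimedean (b + b)
    in Φ N , λ m → ≤-trans (psum-mono 0≤t (ℕ.m≤m+n m N))
        (≤-trans (diff⇒≤ (0≤t (m ℕ.+ N) ⊕ 0≤t (m ℕ.+ N)) (solve 2 (λ s u → s :+ u :- s := u) refl _ _))
          (Φ-decr N (proj₁ 2b<N) m))
    where
    t = term b
    0≤t = term-nonneg 0≤b
    Φ : ℕ → ℝ
    Φ m = psum t m + (t m + t m)
    Φ-decr : ∀ N → b + b ≤ fromℕ N → ∀ d → Φ (d ℕ.+ N) ≤ Φ N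
    Φ-decr N 2b≤N zero    = ≤-refl
    Φ-decr N 2b≤N (suc d) = ≤-trans
      (diff⇒≤ (≤⇒0≤ (term-halving 0≤b (d ℕ.+ N) (≤-trans 2b≤N (fromℕ-mono-≤ (ℕ.m≤n+m N d)))))
        (trans (+-congˡ (-‿cong (+-congʳ (psum-snoc t (d ℕ.+ N)))))
          (solve 3 (λ s u v → s :+ (u :+ u) :- (s :+ u :+ v) := u :- v) refl _ _ _)))
      (Φ-decr N 2b≤N d)

  exp-⇝ : ∀ x → psum (term x) ⇝ exp x
  exp-⇝ x =
    let b , 0≤b , xb = ∃Bd x
        bounded = psum-term-bounded 0≤b
        l , conv = psum-dominated (term-Bd xb)
                     (monotone-convergence _ (psum-step (term-nonneg 0≤b)) bounded) bounded
        s≈ m = reflexive (∑-applyUpTo (term x) id m)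
    in ⇝-cong s≈ refl (lim-⇝ (l , ⇝-cong (λ m → sym (s≈ m)) refl conv))

  exp-cong : ∀ {x y} → x ≈ y → exp x ≈ exp y
  exp-cong {x} {y} x≈y = ⇝-unique (⇝-cong (psum-cong (term-cong x≈y)) refl (exp-⇝ x)) (exp-⇝ y)

  -- Cauchy products and the functional equation of exp

  conv : (ℕ → ℝ) → (ℕ → ℝ) → ℕ → ℝ
  conv a b zero    = a 0 * b 0
  conv a b (suc m) = a 0 * b (suc m) + conv (a ∘ suc) b m

  conv-cong : ∀ {a a′ b b′} → (∀ j → a j ≈ a′ j) → (∀ j → b j ≈ b′ j) → ∀ m → conv a b m ≈ conv a′ b′ m
  conv-cong p q zero    = *-cong (p 0) (q 0)
  conv-cong p q (suc m) = +-cong (*-cong (p 0) (q (suc m))) (conv-cong (p ∘ suc) q m)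

  conv-+ˡ : ∀ a a′ b m → conv (λ j → a j + a′ j) b m ≈ conv a b m + conv a′ b m
  conv-+ˡ a a′ b zero    = distribʳ _ _ _
  conv-+ˡ a a′ b (suc m) = trans (+-congˡ (conv-+ˡ (a ∘ suc) (a′ ∘ suc) b m))
    (solve 5 (λ x y z u v → (x :+ y) :* z :+ (u :+ v) := x :* z :+ u :+ (y :* z :+ v)) refl _ _ _ _ _)

  conv-*ˡ : ∀ c a b m → conv (λ j → c * a j) b m ≈ c * conv a b m
  conv-*ˡ c a b zero    = *-assoc c _ _
  conv-*ˡ c a b (suc m) = trans (+-congˡ (conv-*ˡ c (a ∘ suc) b m))
    (solve 4 (λ c x y u → c :* x :* y :+ c :* u := c :* (x :* y :+ u)) refl c _ _ _)

  conv-*ʳ : ∀ c a b m → conv a (λ j → c * b j) m ≈ c * conv a b m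
  conv-*ʳ c a b zero    = solve 3 (λ c x y → x :* (c :* y) := c :* (x :* y)) refl c _ _
  conv-*ʳ c a b (suc m) = trans (+-congˡ (conv-*ʳ c (a ∘ suc) b m))
    (solve 4 (λ c x y u → x :* (c :* y) :+ c :* u := c :* (x :* y :+ u)) refl c _ _ _)

  -- The coefficient sequence of the derivative of a power series.
  D : (ℕ → ℝ) → ℕ → ℝ
  D a j = fromℕ (suc j) * a (suc j)

  -- The product rule (ab)' = a'b + ab' for power series, read off in degree m.
  conv-leibniz : ∀ a b m → fromℕ (suc m) * conv a b (suc m) ≈ conv (D a) b m + conv a (D b) m
  conv-leibniz a b zero = solve 4 (λ a a′ b b′ → (:1 :+ :0) :* (a :* b′ :+ a′ :* b)
    := (:1 :+ :0) :* a′ :* b :+ a :* ((:1 :+ :0) :* b′)) refl (a 0) (a 1) (b 0) (b 1)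
  conv-leibniz a b (suc m) = begin-equality
    (1# + s) * (a 0 * b″ + (a 1 * b′ + u))
      ≈⟨ solve 6 (λ s a b″ a′ b′ u → (:1 :+ s) :* (a :* b″ :+ (a′ :* b′ :+ u))
           := a :* ((:1 :+ s) :* b″) :+ (a′ :* b′ :+ u) :+ s :* (a′ :* b′ :+ u)) refl s (a 0) b″ (a 1) b′ u ⟩
    a 0 * ((1# + s) * b″) + (a 1 * b′ + u) + s * (a 1 * b′ + u)
      ≈⟨ +-congˡ (conv-leibniz (a ∘ suc) b m) ⟩
    a 0 * ((1# + s) * b″) + (a 1 * b′ + u) + (conv (D (a ∘ suc)) b m + v)
      ≈⟨ solve 6 (λ x a′ b′ u y v → x :+ (a′ :* b′ :+ u) :+ (y :+ v)
           := (:1 :+ :0) :* a′ :* b′ :+ (u :+ y) :+ (x :+ v)) refl _ (a 1) b′ u _ v ⟩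
    (1# + 0#) * a 1 * b′ + (u + conv (D (a ∘ suc)) b m) + (a 0 * ((1# + s) * b″) + v)
      ≈⟨ +-congʳ (+-congˡ (trans (sym (conv-+ˡ (λ j → a (suc (suc j))) (D (a ∘ suc)) b m))
           (conv-cong (λ j → solve 2 (λ y n → y :+ n :* y := (:1 :+ n) :* y) refl _ _) (λ _ → refl) m))) ⟩
    D a 0 * b′ + conv (D a ∘ suc) b m + (a 0 * D b (suc m) + v) ∎
    where
    open ≤R
    s  = fromℕ (suc m)
    b′ = b (suc m)
    b″ = b (suc (suc m))
    u  = conv (λ j → a (suc (suc j))) b m
    v  = conv (a ∘ suc) (D b) m

  -- The binomial theorem without binomial coefficients: by the product rule both sides satisfy (m +
  -- 1) u(m + 1) = (x + y) u(m) and start at 1.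
  conv-term : ∀ x y m → conv (term x) (term y) m ≈ term (x + y) m
  conv-term x y zero = trans (*-cong (term-zero x) (term-zero y)) (trans (*-identityˡ 1#) (sym (term-zero (x + y))))
  conv-term x y (suc m) = *-cancelˡ-≈ (0<fromℕ m) (begin-equality
    fromℕ (suc m) * conv (term x) (term y) (suc m)
      ≈⟨ conv-leibniz (term x) (term y) m ⟩
    conv (D (term x)) (term y) m + conv (term x) (D (term y)) m
      ≈⟨ +-cong (trans (conv-cong (term-suc x) (λ _ → refl) m) (conv-*ˡ x _ _ m))
                (trans (conv-cong (λ _ → refl) (term-suc y) m) (conv-*ʳ y (term x) _ m)) ⟩
    x * conv (term x) (term y) m + y * conv (term x) (term y) m
      ≈⟨ sym (distribʳ _ x y) ⟩
    (x + y) * conv (term x) (term y) m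
      ≈⟨ *-congˡ (conv-term x y m) ⟩
    (x + y) * term (x + y) m
      ≈⟨ sym (term-suc (x + y) m) ⟩
    fromℕ (suc m) * term (x + y) (suc m) ∎)
    where open ≤R

  -- The sum of a i * b j over the triangle i + j < m.
  tri : (ℕ → ℝ) → (ℕ → ℝ) → ℕ → ℝ
  tri a b zero    = 0#
  tri a b (suc m) = a 0 * psum b (suc m) + tri (a ∘ suc) b m

  -- Enlarging the triangle by one adds the antidiagonal i + j = m.
  tri-suc : ∀ a b m → tri a b (suc m) ≈ tri a b m + conv a b m
  tri-suc a b zero    = solve 2 (λ a b → a :* (b :+ :0) :+ :0 := :0 :+ a :* b) refl (a 0) (b 0)
  tri-suc a b (suc m) = trans (+-cong (*-congˡ (psum-snoc b (suc m))) (tri-suc (a ∘ suc) b m))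
    (solve 5 (λ a s b t c → a :* (s :+ b) :+ (t :+ c) := a :* s :+ t :+ (a :* b :+ c)) refl (a 0) _ _ _ _)

  tri-term : ∀ x y m → tri (term x) (term y) m ≈ psum (term (x + y)) m
  tri-term x y zero    = refl
  tri-term x y (suc m) = trans (tri-suc _ _ m)
    (trans (+-cong (tri-term x y m) (conv-term x y m)) (sym (psum-snoc _ m)))

  -- For m ≤ n the triangle lies inside the m by n rectangle, so the difference is a sum of products
  -- a i * b j over the cells in between, and each is dominated.
  square-tri-Bd : ∀ {a b a′ b′} → (∀ j → Bd (a j) (a′ j)) → (∀ j → Bd (b j) (b′ j)) → ∀ {m n} → m ℕ.≤ n →
                  Bd (psum a m * psum b n - tri a b m) (psum a′ m * psum b′ n - tri a′ b′ m)
  square-tri-Bd aa′ bb′ ℕ.z≤n = Bd-resp (sym (lem _)) (sym (lem _)) (0≤x⇒Bd ≤-refl)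
    where
    lem : ∀ x → 0# * x - 0# ≈ 0#
    lem = solve 1 (λ x → :0 :* x :- :0 := :0) refl
  square-tri-Bd aa′ bb′ {suc m} (ℕ.s≤s m≤n) = Bd-resp (lem _ _ _ _ _) (lem _ _ _ _ _)
    (Bd-+ (Bd-* (aa′ 0) (psum-Bd bb′ (ℕ.s≤s m≤n)))
          (square-tri-Bd (aa′ ∘ suc) bb′ (ℕ.m≤n⇒m≤1+n m≤n)))
    where
    lem : ∀ a bn bm s t → a * (bn - bm) + (s * bn - t) ≈ (a + s) * bn - (a * bm + t)
    lem = solve 5 (λ a bn bm s t → a :* (bn :- bm) :+ (s :* bn :- t) := (a :+ s) :* bn :- (a :* bm :+ t)) refl

  -- All terms are nonnegative and the m by n rectangle lies in the triangle i + j < m + n.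
  square≤tri : ∀ {a b} → (∀ j → 0# ≤ a j) → (∀ j → 0# ≤ b j) → ∀ m n → psum a m * psum b n ≤ tri a b (m ℕ.+ n)
  square≤tri {a} {b} 0≤a 0≤b zero n = ≤-respˡ-≈ (sym (zeroˡ _)) (tri-nonneg 0≤a n)
    where
    tri-nonneg : ∀ {a} → (∀ j → 0# ≤ a j) → ∀ n → 0# ≤ tri a b n
    tri-nonneg 0≤a zero    = ≤-refl
    tri-nonneg 0≤a (suc n) = 0≤a 0 ⊗ psum-nonneg 0≤b (suc n) ⊕ tri-nonneg (0≤a ∘ suc) n
  square≤tri 0≤a 0≤b (suc m) n = ≤-respˡ-≈ (sym (distribʳ _ _ _))
    (+-mono-≤ (*-monoˡ-≤ (0≤a 0) (psum-mono 0≤b (ℕ.m≤n+m n (suc m))))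
              (square≤tri (0≤a ∘ suc) 0≤b m n))

  -- With |x| ≤ b and |y| ≤ c, the difference between the square of side 2m and its triangle is
  -- dominated by the same difference for b and c. That triangle contains the square of side m, so
  -- the difference is at most square 2m minus square m for b and c, which tends to 0.
  exp-+ : ∀ x y → exp (x + y) ≈ exp x * exp y
  exp-+ x y =
    let b , 0≤b , xb = ∃Bd x
        c , 0≤c , yc = ∃Bd y
        SQ u v m = psum (term u) m * psum (term v) m
        sq : ∀ u v → SQ u v ⇝ exp u * exp v
        sq u v = ⇝-* (exp-⇝ u) (exp-⇝ v)
        up : (λ m → SQ b c (m ℕ.+ m) - SQ b c m) ⇝ exp b * exp c - exp b * exp c
        up = ⇝-+ (⇝-double (sq b c)) (⇝-neg (sq b c))
        mid : (λ m → SQ x y (m ℕ.+ m) - psum (term (x + y)) (m ℕ.+ m)) ⇝ exp x * exp y - exp (x + y)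
        mid = ⇝-+ (⇝-double (sq x y)) (⇝-neg (⇝-double (exp-⇝ (x + y))))
        bd : ∀ m → Bd (SQ x y (m ℕ.+ m) - psum (term (x + y)) (m ℕ.+ m)) (SQ b c (m ℕ.+ m) - SQ b c m)
        bd m = Bd-weaken (+-monoʳ-≤ _ (neg-mono-≤ (square≤tri (term-nonneg 0≤b) (term-nonneg 0≤c) m m)))
          (Bd-resp (+-congˡ (-‿cong (tri-term x y (m ℕ.+ m)))) refl
            (square-tri-Bd (term-Bd xb) (term-Bd yc) (ℕ.≤-refl {m ℕ.+ m})))
        d≤0 = ≤-respʳ-≈ (-‿inverseʳ _) (⇝-≤ mid up (0 , λ m _ → proj₂ (bd m)))
        0≤d = ≤-respˡ-≈ (trans (-‿cong (-‿inverseʳ _)) (solve 0 (:- :0 := :0) refl))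
                (⇝-≤ (⇝-neg up) mid (0 , λ m _ → proj₁ (bd m)))
    in antisym (diff⇒≤ 0≤d refl) (diff⇒≤ (≤⇒0≤ d≤0) (solve 2 (λ x y → y :- x := :0 :- (x :- y)) refl _ _))

  -- Exponential inequalities, logarithm and square root

  1+x≤exp⁺ : ∀ {x} → 0# ≤ x → 1# + x ≤ exp x
  1+x≤exp⁺ {x} 0≤x = ⇝-≤ (⇝-const (λ _ → refl)) (exp-⇝ x)
    (2 , λ m 2≤m → ≤-respˡ-≈ (+-cong (term-zero x) (trans (+-identityʳ _) term-one)) (psum-mono (term-nonneg 0≤x) 2≤m))
    where
    term-one : term x 1 ≈ x
    term-one = trans (solve 1 (λ t → t := (:1 :+ :0) :* t) refl _)
      (trans (term-suc x 0) (trans (*-congˡ (term-zero x)) (*-identityʳ x)))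

  exp-0 : exp 0# ≈ 1#
  exp-0 = *-cancelˡ-≈ (<-≤-trans 0<1 (≤-respˡ-≈ (+-identityʳ 1#) (1+x≤exp⁺ ≤-refl)))
    (trans (sym (exp-+ 0# 0#)) (trans (exp-cong (+-identityʳ 0#)) (sym (*-identityʳ _))))

  exp-neg : ∀ x → exp x * exp (- x) ≈ 1#
  exp-neg x = trans (sym (exp-+ x (- x))) (trans (exp-cong (-‿inverseʳ x)) exp-0)

  -- It is the square of exp (x/2), and exp (-x) inverts it, so it is not zero.
  0<exp : ∀ x → 0# < exp x
  0<exp x = ≤-respʳ-≈ (trans (sym (exp-+ _ _)) (exp-cong (halves x))) (0≤x² (exp (x * ½))) ,
    λ 0≈ → 0≉1 (trans (sym (zeroˡ _)) (trans (*-congʳ 0≈) (exp-neg x)))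

  -- The bound by the geometric series 1 / (1 - y), multiplied out so that it also covers y ≥ 1. The
  -- partial sums telescope because each term is at most y times the one before.
  exp-geometric : ∀ {y} → 0# ≤ y → exp y * (1# - y) ≤ 1#
  exp-geometric {y} 0≤y = ⇝-≤ (⇝-* (exp-⇝ y) (⇝-const (λ _ → refl))) (⇝-const (λ _ → refl))
    (0 , λ m _ → ≤-trans (partial m) (diff⇒≤ (term-nonneg 0≤y m) (solve 1 (λ t → :1 :- (:1 :- t) := t) refl _)))
    where
    term-decr : ∀ m → term y (suc m) ≤ y * term y m
    term-decr m = diff⇒≤ (0≤fromℕ m ⊗ term-nonneg 0≤y (suc m))
      (trans (+-congʳ (sym (term-suc y m))) (solve 2 (λ n t → (:1 :+ n) :* t :- t := n :* t) refl _ _))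
    partial : ∀ m → psum (term y) m * (1# - y) ≤ 1# - term y m
    partial zero    = ≤-reflexive (trans (zeroˡ _) (sym (trans (+-congˡ (-‿cong (term-zero y))) (-‿inverseʳ 1#))))
    partial (suc m) = diff⇒≤ (≤⇒0≤ (partial m) ⊕ ≤⇒0≤ (term-decr m))
      (trans (+-congˡ (-‿cong (*-congʳ (psum-snoc (term y) m))))
        (solve 4 (λ s t t′ y → :1 :- t′ :- (s :+ t) :* (:1 :- y) := :1 :- t :- s :* (:1 :- y) :+ (y :* t :- t′))
          refl _ _ _ _))

  -- For x ≤ 0 the series has terms of both signs, so the claim is multiplied by exp (-x) and
  -- becomes `exp-geometric` at -x.
  1+x≤exp : ∀ x → 1# + x ≤ exp x
  1+x≤exp x with total 0# x
  ... | inj₁ 0≤x = 1+x≤exp⁺ 0≤x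
  ... | inj₂ x≤0 = *-cancelˡ-≤ (0<exp (- x)) (≤-resp₂
          (*-congˡ (solve 1 (λ x → :1 :- (:- x) := :1 :+ x) refl x))
          (trans (sym (exp-neg x)) (*-comm _ _))
          (exp-geometric (≤-respʳ-≈ (+-identityˡ _) (≤⇒0≤ x≤0))))

  -- Convexity in tangent-line form; monotonicity of exp and its converse both come from it.
  exp-≤-via : ∀ {x y} → exp x * (1# + (y - x)) ≤ exp y
  exp-≤-via {x} {y} = ≤-respʳ-≈ (trans (sym (exp-+ x (y - x))) (exp-cong (solve 2 (λ x y → x :+ (y :- x) := y) refl x y)))
    (*-monoˡ-≤ (proj₁ (0<exp x)) (1+x≤exp (y - x)))

  exp-mono : ∀ {x y} → x ≤ y → exp x ≤ exp y
  exp-mono {x} {y} x≤y = ≤-trans (diff⇒≤ (proj₁ (0<exp x) ⊗ ≤⇒0≤ x≤y)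
    (solve 2 (λ e d → e :* (:1 :+ d) :- e := e :* d) refl _ _)) exp-≤-via

  exp-reflects-≤ : ∀ {x y} → exp x ≤ exp y → x ≤ y
  exp-reflects-≤ {x} {y} ex≤ey = diff⇒≤ (≤⇒0≤ (*-cancelˡ-≤ (0<exp y) (≤-trans exp-≤-via (≤-trans ex≤ey (≤-reflexive (sym (*-identityʳ _)))))))
    (solve 2 (λ x y → y :- x := :1 :- (:1 :+ (x :- y))) refl x y)

  -- From exp u ≤ 1 / (1 - u).
  exp-quadratic : ∀ {u} → Bd u ½ → exp u ≤ 1# + u + 2# * (u * u)
  exp-quadratic {u} bd = *-cancelˡ-≤ 0<1-u (≤-trans
      (≤-resp₂ (*-comm _ _) (exp-neg u) (*-monoˡ-≤ (proj₁ (0<exp u)) (1+x≤exp (- u))))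
      (diff⇒≤ (0≤x² u ⊗ 0≤1-2u)
        (solve 1 (λ u → (:1 :+ :- u) :* (:1 :+ u :+ :2 :* (u :* u)) :- :1 := u :* u :* (:1 :- :2 :* u)) refl u)))
    where
    ½+½ : ½ + ½ ≈ 1#
    ½+½ = trans (sym (+-cong (*-identityˡ ½) (*-identityˡ ½))) (halves 1#)
    0≤1-2u : 0# ≤ 1# - 2# * u
    0≤1-2u = ≤-respʳ-≈ (trans (solve 2 (λ h u → h :- u :+ (h :- u) := h :+ h :- :2 :* u) refl ½ u) (+-congʳ ½+½))
      (Bd⁻ bd ⊕ Bd⁻ bd)
    0<1-u : 0# < 1# + - u
    0<1-u = <-≤-trans 0<½ (diff⇒≤ (Bd⁻ bd) (trans (+-congʳ (+-congʳ (sym ½+½)))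
      (solve 2 (λ h u → h :+ h :+ :- u :- h := h :- u) refl ½ u)))

  exp-fromℕ-* : ∀ k x → exp (fromℕ k * x) ≈ exp x ^ k
  exp-fromℕ-* zero    x = trans (exp-cong (zeroˡ x)) exp-0
  exp-fromℕ-* (suc k) x = trans (exp-cong (solve 2 (λ n x → (:1 :+ n) :* x := x :+ n :* x) refl _ x))
    (trans (exp-+ x _) (*-congˡ (exp-fromℕ-* k x)))

  the-spec : ∀ {P} → ∃ P → P (the P)
  the-spec {P} (x , Px) with em {∃ P}
  ... | yes (_ , Py) = Py
  ... | no  none     = ⊥-elim (none (x , Px))

  -- The supremum s of all y with exp y ≤ x works. Continuity is replaced by explicit steps h that
  -- would move s if exp s differed from x.
  exp-surjective : ∀ {x} → 0# < x → ∃ λ y → exp y ≈ x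
  exp-surjective {x} 0<x = s , antisym (≮⇒≥ too-large) (≮⇒≥ too-small)
    where
    E : ℝ → Set
    E y = exp y ≤ x
    E-bounded : UpperBound E x
    E-bounded y ey≤x = ≤-trans (diff⇒≤ 0≤1 (solve 1 (λ y → :1 :+ y :- y := :1) refl y)) (≤-trans (1+x≤exp y) ey≤x)
    E-inhabited : E (- (x ⁻¹))
    E-inhabited = *-cancelˡ-≤ (0<exp (x ⁻¹)) (≤-trans (≤-reflexive (exp-neg (x ⁻¹)))
      (≤-respˡ-≈ (trans (*-comm _ _) (⁻¹-inverseʳ 0<x)) (*-mono-≤ (proj₁ 0<x) (proj₁ (0<exp _))
        (≤-trans (diff⇒≤ 0≤1 (solve 1 (λ y → :1 :+ y :- y := :1) refl _)) (1+x≤exp (x ⁻¹))) ≤-refl)))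
    S = supremum E (- (x ⁻¹) , E-inhabited) (x , E-bounded)
    s = proj₁ S
    too-small : ¬ (exp s < x)
    too-small es<x = <⇒≱ 0<h (diff⇒≤ (≤⇒0≤ (proj₁ (proj₂ S) (s + h) s+h∈E)) (solve 2 (λ s h → :0 :- h := s :- (s :+ h)) refl s h))
      where
      -- Chosen so that x(1 - h) = exp s; then exp (s + h) ≤ exp s / (1 - h) = x.
      h = (x - exp s) / x
      0<h = /-pos (<⇒0< es<x) 0<x
      x[1-h]≈es : x * (1# - h) ≈ exp s
      x[1-h]≈es = trans (solve 2 (λ x h → x :* (:1 :- h) := x :- x :* h) refl x h)
        (trans (+-congˡ (-‿cong (*-/-cancel 0<x))) (solve 2 (λ x e → x :- (x :- e) := e) refl x (exp s)))
      s+h∈E : exp (s + h) ≤ x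
      s+h∈E = ≤-respˡ-≈ (sym (exp-+ s h)) (≤-resp₂
        (trans (solve 3 (λ x e h → x :* (e :* (:1 :- h)) := x :* (:1 :- h) :* e) refl x (exp h) h) (*-congʳ x[1-h]≈es))
        (*-identityʳ x)
        (*-monoˡ-≤ (proj₁ 0<x) (exp-geometric (proj₁ 0<h))))
    too-large : ¬ (x < exp s)
    too-large x<es = <⇒≱ 0<h (diff⇒≤ (≤⇒0≤ (proj₂ (proj₂ S) (s - h) s-h-upper)) (solve 2 (λ s h → :0 :- h := s :- h :- s) refl s h))
      where
      -- Chosen so that the tangent at s takes the value x at s - h; hence x ≤ exp (s - h), and s -
      -- h is already an upper bound.
      h = (exp s - x) / exp s
      0<h = /-pos (<⇒0< x<es) (0<exp s)
      es[1-h]≈x : exp s * (1# + (s - h - s)) ≈ x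
      es[1-h]≈x = trans (solve 3 (λ x h s → x :* (:1 :+ (s :- h :- s)) := x :- x :* h) refl (exp s) h s)
        (trans (+-congˡ (-‿cong (*-/-cancel (0<exp s)))) (solve 2 (λ x e → e :- (e :- x) := x) refl x (exp s)))
      s-h-upper : UpperBound E (s - h)
      s-h-upper y ey≤x = exp-reflects-≤ (≤-trans ey≤x (≤-trans (≤-reflexive (sym es[1-h]≈x)) exp-≤-via))

  exp-ln : ∀ {x} → 0# < x → exp (ln x) ≈ x
  exp-ln 0<x = the-spec (exp-surjective 0<x)

  √-spec : ∀ {x} → 0# < x → 0# ≤ √ x × √ x * √ x ≈ x
  √-spec {x} 0<x = the-spec {λ y → (0# ≤ y) × (y * y ≈ x)} (exp (ln x * ½) , proj₁ (0<exp _) ,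
    trans (sym (exp-+ _ _)) (trans (exp-cong (halves (ln x))) (exp-ln 0<x)))

  0<√ : ∀ {x} → 0# < x → 0# < √ x
  0<√ 0<x = proj₁ (√-spec 0<x) , λ 0≈√ → proj₂ 0<x
    (trans (sym (zeroˡ _)) (trans (*-congʳ 0≈√) (proj₂ (√-spec 0<x))))

  -- Finite sums

  ∑-cong : ∀ {A : Set} (xs : List A) {f g : A → ℝ} → (∀ x → f x ≈ g x) → ∑ xs f ≈ ∑ xs g
  ∑-cong []       f≈g = refl
  ∑-cong (x ∷ xs) f≈g = +-cong (f≈g x) (∑-cong xs f≈g)

  ∑-mono : ∀ {A : Set} (xs : List A) {f g : A → ℝ} → (∀ x → f x ≤ g x) → ∑ xs f ≤ ∑ xs g
  ∑-mono []       f≤g = ≤-refl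
  ∑-mono (x ∷ xs) f≤g = +-mono-≤ (f≤g x) (∑-mono xs f≤g)

  ∑-nonneg : ∀ {A : Set} (xs : List A) {f : A → ℝ} → (∀ x → 0# ≤ f x) → 0# ≤ ∑ xs f
  ∑-nonneg []       0≤f = ≤-refl
  ∑-nonneg (x ∷ xs) 0≤f = 0≤f x ⊕ ∑-nonneg xs 0≤f

  ∑-++ : ∀ {A : Set} (xs ys : List A) (f : A → ℝ) → ∑ (xs ++ ys) f ≈ ∑ xs f + ∑ ys f
  ∑-++ []       ys f = sym (+-identityˡ _)
  ∑-++ (x ∷ xs) ys f = trans (+-congˡ (∑-++ xs ys f)) (sym (+-assoc _ _ _))

  ∑-map : ∀ {A B : Set} (g : A → B) xs (f : B → ℝ) → ∑ (List.map g xs) f ≈ ∑ xs (f ∘ g)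
  ∑-map g []       f = refl
  ∑-map g (x ∷ xs) f = +-congˡ (∑-map g xs f)

  ∑-* : ∀ {A : Set} c (xs : List A) (f : A → ℝ) → ∑ xs (λ x → c * f x) ≈ c * ∑ xs f
  ∑-* c []       f = sym (zeroʳ c)
  ∑-* c (x ∷ xs) f = trans (+-congˡ (∑-* c xs f)) (sym (distribˡ c _ _))

  ∑-+ : ∀ {A : Set} (xs : List A) (f g : A → ℝ) → ∑ xs (λ x → f x + g x) ≈ ∑ xs f + ∑ xs g
  ∑-+ []       f g = sym (+-identityʳ 0#)
  ∑-+ (x ∷ xs) f g = trans (+-congˡ (∑-+ xs f g))
    (solve 4 (λ a b c d → a :+ b :+ (c :+ d) := a :+ c :+ (b :+ d)) refl _ _ _ _)

  ∑-swap : ∀ {A B : Set} (xs : List A) (ys : List B) (f : A → B → ℝ) →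
           ∑ xs (λ x → ∑ ys (f x)) ≈ ∑ ys (λ y → ∑ xs (λ x → f x y))
  ∑-swap []       ys f = sym (zero-sum ys)
    where
    zero-sum : ∀ {B : Set} (ys : List B) → ∑ ys (λ _ → 0#) ≈ 0#
    zero-sum []       = refl
    zero-sum (y ∷ ys) = trans (+-identityˡ _) (zero-sum ys)
  ∑-swap (x ∷ xs) ys f = trans (+-congˡ (∑-swap xs ys f)) (sym (∑-+ ys (f x) _))

  ∑-cartesianProductWith : ∀ {A B C : Set} (g : A → B → C) xs ys (f : C → ℝ) →
    ∑ (cartesianProductWith g xs ys) f ≈ ∑ xs (λ x → ∑ ys (λ y → f (g x y)))
  ∑-cartesianProductWith g []       ys f = refl
  ∑-cartesianProductWith g (x ∷ xs) ys f = trans (∑-++ (List.map (g x) ys) _ f)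
    (+-cong (∑-map (g x) ys f) (∑-cartesianProductWith g xs ys f))

  -- Recursive over the membership vector of K, so that it unfolds together with a graph; `∑∈-∁`
  -- identifies it with the filtered sum of the theorem.
  ∑∉ : ∀ {n} → Subset n → (Fin n → ℝ) → ℝ
  ∑∉ []          f = 0#
  ∑∉ (true ∷ K)  f = ∑∉ K (f ∘ suc)
  ∑∉ (false ∷ K) f = f zero + ∑∉ K (f ∘ suc)

  ∑∉-cong : ∀ {n} (K : Subset n) {f g} → (∀ i → f i ≈ g i) → ∑∉ K f ≈ ∑∉ K g
  ∑∉-cong []          f≈g = refl
  ∑∉-cong (true ∷ K)  f≈g = ∑∉-cong K (f≈g ∘ suc)
  ∑∉-cong (false ∷ K) f≈g = +-cong (f≈g zero) (∑∉-cong K (f≈g ∘ suc))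

  bit : Bool → ℝ
  bit b = if b then 1# else 0#

  ∑-filter-tabulate : ∀ {A : Set} {P : A → Set} (P? : Decidable P) {n} (g : Fin n → A) (K : Subset n) (f : A → ℝ) →
    (∀ i → does (P? (g i)) ≡ not (lookup K i)) → ∑ (List.filter P? (List.tabulate g)) f ≈ ∑∉ K (f ∘ g)
  ∑-filter-tabulate P? g []      f hyp = refl
  ∑-filter-tabulate P? g (b ∷ K) f hyp with does (P? (g zero)) | b | hyp zero
  ... | false | true  | _ = ∑-filter-tabulate P? (g ∘ suc) K f (hyp ∘ suc)
  ... | true  | false | _ = +-congˡ (∑-filter-tabulate P? (g ∘ suc) K f (hyp ∘ suc))

  ∈?-∁ : ∀ {n} (K : Subset n) i → does (i ∈? ∁ K) ≡ not (lookup K i)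
  ∈?-∁ (true ∷ K)  zero    = ≡.refl
  ∈?-∁ (false ∷ K) zero    = ≡.refl
  ∈?-∁ (b ∷ K)     (suc i) = ∈?-∁ K i

  ∑∈-∁ : ∀ {n} (K : Subset n) f → ∑∈ (∁ K) f ≈ ∑∉ K f
  ∑∈-∁ K f = ∑-filter-tabulate (_∈? ∁ K) id K f (∈?-∁ K)

  ∑∉-const : ∀ {n} (K : Subset n) c → ∑∉ K (λ _ → c) ≈ (fromℕ n - fromℕ (∣ K ∣)) * c
  ∑∉-const []          c = solve 1 (λ c → :0 := (:0 :- :0) :* c) refl c
  ∑∉-const (true ∷ K)  c = trans (∑∉-const K c)
    (solve 3 (λ n k c → (n :- k) :* c := (:1 :+ n :- (:1 :+ k)) :* c) refl _ _ c)
  ∑∉-const (false ∷ K) c = trans (+-congˡ (∑∉-const K c))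
    (solve 3 (λ n k c → c :+ (n :- k) :* c := (:1 :+ n :- k) :* c) refl _ _ c)

  ∑∉-* : ∀ {n} (K : Subset n) c f → ∑∉ K (λ i → c * f i) ≈ c * ∑∉ K f
  ∑∉-* []          c f = sym (zeroʳ c)
  ∑∉-* (true ∷ K)  c f = ∑∉-* K c (f ∘ suc)
  ∑∉-* (false ∷ K) c f = trans (+-congˡ (∑∉-* K c (f ∘ suc))) (sym (distribˡ c _ _))

  ∑∉-≤ : ∀ {n} (K : Subset n) {f c} → 0# ≤ c → (∀ i → f i ≤ c) → ∑∉ K f ≤ fromℕ n * c
  ∑∉-≤ []          {c = c} 0≤c f≤c = ≤-reflexive (sym (zeroˡ c))
  ∑∉-≤ (true ∷ K)  {c = c} 0≤c f≤c = ≤-trans (∑∉-≤ K 0≤c (f≤c ∘ suc))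
    (diff⇒≤ 0≤c (solve 2 (λ n c → (:1 :+ n) :* c :- n :* c := c) refl _ c))
  ∑∉-≤ (false ∷ K) {c = c} 0≤c f≤c = ≤-respʳ-≈ (solve 2 (λ n c → c :+ n :* c := (:1 :+ n) :* c) refl _ c)
    (+-mono-≤ (f≤c zero) (∑∉-≤ K 0≤c (f≤c ∘ suc)))

  𝟙 : ∀ {P : Set} → Dec P → ℝ → ℝ
  𝟙 d x = if does d then x else 0#

  𝟙-mono : ∀ {P : Set} (d : Dec P) {x y} → (P → x ≤ y) → 𝟙 d x ≤ 𝟙 d y
  𝟙-mono (yes p) x≤y = x≤y p
  𝟙-mono (no _)  x≤y = ≤-refl

  𝟙-nonneg : ∀ {P : Set} (d : Dec P) {x} → 0# ≤ x → 0# ≤ 𝟙 d x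
  𝟙-nonneg (yes _) 0≤x = 0≤x
  𝟙-nonneg (no _)  0≤x = ≤-refl

  𝟙-yes : ∀ {P : Set} (d : Dec P) {x} → P → 𝟙 d x ≈ x
  𝟙-yes (yes _) p = refl
  𝟙-yes (no ¬p) p = ⊥-elim (¬p p)

  𝟙-* : ∀ {P : Set} (d : Dec P) m x → m * 𝟙 d x ≈ 𝟙 d (m * x)
  𝟙-* (yes _) m x = refl
  𝟙-* (no _)  m x = zeroʳ m

  𝟙-∑ : ∀ {P A : Set} (d : Dec P) (xs : List A) f → ∑ xs (λ x → 𝟙 d (f x)) ≈ 𝟙 d (∑ xs f)
  𝟙-∑ (yes _) xs       f = refl
  𝟙-∑ (no _)  []       f = refl
  𝟙-∑ (no ¬p) (x ∷ xs) f = trans (+-identityˡ _) (𝟙-∑ (no ¬p) xs f)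

  ∑-subsets-suc : ∀ n f → ∑ (subsets (suc n)) f ≈
    ∑ (subsets n) (λ K → f (true ∷ K)) + ∑ (subsets n) (λ K → f (false ∷ K))
  ∑-subsets-suc n f = trans (∑-++ (List.map (inside ∷_) (subsets n)) _ f)
    (+-cong (∑-map (inside ∷_) (subsets n) f) (∑-map (outside ∷_) (subsets n) f))

  ≤∑-subsets : ∀ {n} (K : Subset n) f → (∀ K → 0# ≤ f K) → f K ≤ ∑ (subsets n) f
  ≤∑-subsets [] f 0≤f = ≤-reflexive (sym (+-identityʳ _))
  ≤∑-subsets {suc n} (true ∷ K) f 0≤f = ≤-respʳ-≈ (sym (∑-subsets-suc n f))
    (≤-trans (≤-reflexive (sym (+-identityʳ _)))
      (+-mono-≤ (≤∑-subsets K (λ K → f (true ∷ K)) λ K → 0≤f _) (∑-nonneg (subsets n) λ K → 0≤f _)))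
  ≤∑-subsets {suc n} (false ∷ K) f 0≤f = ≤-respʳ-≈ (sym (∑-subsets-suc n f))
    (≤-trans (≤-reflexive (sym (+-identityˡ _)))
      (+-mono-≤ (∑-nonneg (subsets n) λ K → 0≤f _) (≤∑-subsets K (λ K → f (false ∷ K)) λ K → 0≤f _)))

  ^-mono-≤ : ∀ {x y} → 0# ≤ x → x ≤ y → ∀ k → x ^ k ≤ y ^ k
  ^-mono-≤ 0≤x x≤y zero    = ≤-refl
  ^-mono-≤ 0≤x x≤y (suc k) = *-mono-≤ (^-nonneg 0≤x k) (≤-trans 0≤x x≤y) x≤y (^-mono-≤ 0≤x x≤y k)

  -- The count of k-sets is at most n^k, by Pascal's rule: n^k + n^(k+1) = (1 + n) n^k ≤ (1 +
  -- n)^(k+1).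
  ∑-subsets-of-size : ∀ n k {B} → 0# ≤ B → ∑ (subsets n) (λ K → 𝟙 (∣ K ∣ ℕ.≟ k) B) ≤ fromℕ n ^ k * B
  ∑-subsets-of-size zero zero    {B} 0≤B = ≤-reflexive (trans (+-identityʳ B) (sym (*-identityˡ B)))
  ∑-subsets-of-size zero (suc k) {B} 0≤B = ≤-respˡ-≈ (sym (+-identityʳ 0#)) (^-nonneg ≤-refl (suc k) ⊗ 0≤B)
  ∑-subsets-of-size (suc n) zero {B} 0≤B = ≤-respˡ-≈
    (sym (trans (∑-subsets-suc n _) (trans (+-congʳ (𝟙-∑ (1 ℕ.≟ 0) (subsets n) (λ _ → B))) (+-identityˡ _))))
    (∑-subsets-of-size n zero 0≤B)
  ∑-subsets-of-size (suc n) (suc k) {B} 0≤B = begin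
    ∑ (subsets (suc n)) (λ K → 𝟙 (∣ K ∣ ℕ.≟ suc k) B)
      ≈⟨ ∑-subsets-suc n _ ⟩
    ∑ (subsets n) (λ K → 𝟙 (∣ K ∣ ℕ.≟ k) B) + ∑ (subsets n) (λ K → 𝟙 (∣ K ∣ ℕ.≟ suc k) B)
      ≤⟨ +-mono-≤ (∑-subsets-of-size n k 0≤B) (∑-subsets-of-size n (suc k) 0≤B) ⟩
    N ^ k * B + N * N ^ k * B
      ≈⟨ solve 3 (λ n y b → y :* b :+ n :* y :* b := (:1 :+ n) :* b :* y) refl N (N ^ k) B ⟩
    (1# + N) * B * N ^ k
      ≤⟨ *-monoˡ-≤ (0≤fromℕ (suc n) ⊗ 0≤B) (^-mono-≤ (0≤fromℕ n) (fromℕ-mono-≤ (ℕ.n≤1+n n)) k) ⟩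
    (1# + N) * B * (1# + N) ^ k
      ≈⟨ solve 3 (λ n y b → n :* b :* y := n :* y :* b) refl (1# + N) ((1# + N) ^ k) B ⟩
    (1# + N) ^ suc k * B ∎
    where
    open ≤R
    N = fromℕ n

  -- Expectations over G(n,p)

  module RandomGraph (p : ℝ) (0≤p : 0# ≤ p) (p≤1 : p ≤ 1#) where

    q : ℝ
    q = 1# - p

    0≤q : 0# ≤ q
    0≤q = ≤⇒0≤ p≤1

    average : ∀ x → p * x + q * x ≈ x
    average = solve 2 (λ p x → p :* x :+ (:1 :- p) :* x := x) refl p

    rowMass-nonneg : ∀ {n} (s : Subset n) → 0# ≤ rowMass p s
    rowMass-nonneg []          = 0≤1
    rowMass-nonneg (true ∷ s)  = 0≤p ⊗ rowMass-nonneg s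
    rowMass-nonneg (false ∷ s) = 0≤q ⊗ rowMass-nonneg s

    mass-nonneg : ∀ {n} (G : Graph n) → 0# ≤ mass p G
    mass-nonneg ∅       = 0≤1
    mass-nonneg (s ▷ G) = rowMass-nonneg s ⊗ mass-nonneg G

    Eʳ : ∀ n → (Subset n → ℝ) → ℝ
    Eʳ n f = ∑ (subsets n) λ s → rowMass p s * f s

    E : ∀ n → (Graph n → ℝ) → ℝ
    E n f = ∑ (graphs n) λ G → mass p G * f G

    Eʳ-cong : ∀ n {f g : Subset n → ℝ} → (∀ s → f s ≈ g s) → Eʳ n f ≈ Eʳ n g
    Eʳ-cong n f≈g = ∑-cong (subsets n) λ s → *-congˡ (f≈g s)

    Eʳ-mono : ∀ n {f g : Subset n → ℝ} → (∀ s → f s ≤ g s) → Eʳ n f ≤ Eʳ n g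
    Eʳ-mono n f≤g = ∑-mono (subsets n) λ s → *-monoˡ-≤ (rowMass-nonneg s) (f≤g s)

    E-cong : ∀ n {f g : Graph n → ℝ} → (∀ G → f G ≈ g G) → E n f ≈ E n g
    E-cong n f≈g = ∑-cong (graphs n) λ G → *-congˡ (f≈g G)

    Eʳ-nonneg : ∀ n {f : Subset n → ℝ} → (∀ s → 0# ≤ f s) → 0# ≤ Eʳ n f
    Eʳ-nonneg n 0≤f = ∑-nonneg (subsets n) λ s → rowMass-nonneg s ⊗ 0≤f s

    Eʳ-* : ∀ n c (f : Subset n → ℝ) → Eʳ n (λ s → c * f s) ≈ c * Eʳ n f
    Eʳ-* n c f = trans (∑-cong (subsets n) λ s → solve 3 (λ m c f → m :* (c :* f) := c :* (m :* f)) refl _ c _)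
      (∑-* c (subsets n) _)

    E-* : ∀ n c (f : Graph n → ℝ) → E n (λ G → c * f G) ≈ c * E n f
    E-* n c f = trans (∑-cong (graphs n) λ G → solve 3 (λ m c f → m :* (c :* f) := c :* (m :* f)) refl _ c _)
      (∑-* c (graphs n) _)

    Eʳ-suc : ∀ n f → Eʳ (suc n) f ≈ p * Eʳ n (λ s → f (true ∷ s)) + q * Eʳ n (λ s → f (false ∷ s))
    Eʳ-suc n f = trans (∑-++ (List.map (inside ∷_) (subsets n)) _ _)
      (+-cong (branch inside) (branch outside))
      where
      branch : ∀ b → ∑ (List.map (b ∷_) (subsets n)) (λ s → rowMass p s * f s) ≈
                     (if b then p else q) * Eʳ n (λ s → f (b ∷ s))
      branch b = trans (∑-map (b ∷_) (subsets n) _)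
        (trans (∑-cong (subsets n) λ s → *-assoc _ _ _) (∑-* _ (subsets n) _))

    E-suc : ∀ n f → E (suc n) f ≈ Eʳ n (λ s → E n (λ G → f (s ▷ G)))
    E-suc n f = trans (∑-cartesianProductWith _▷_ (subsets n) (graphs n) _)
      (∑-cong (subsets n) λ s → trans (∑-cong (graphs n) λ G → *-assoc _ _ _) (∑-* _ (graphs n) _))

    Eʳ-1 : ∀ n → Eʳ n (λ _ → 1#) ≈ 1#
    Eʳ-1 zero    = trans (+-identityʳ _) (*-identityˡ 1#)
    Eʳ-1 (suc n) = trans (Eʳ-suc n _) (trans (average _) (Eʳ-1 n))

    E-1 : ∀ n → E n (λ _ → 1#) ≈ 1#
    E-1 zero    = trans (+-identityʳ _) (*-identityˡ 1#)
    E-1 (suc n) = trans (E-suc n _) (trans (Eʳ-cong n λ _ → E-1 n) (Eʳ-1 n))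

    -- The bits of a row are independent, so the exponential moment is a product over positions;
    -- positions in K do not enter the exponent and average out.
    Eʳ-exp-∑∉ : ∀ {n} (K : Subset n) (h : Fin n → Bool → ℝ) (c : Fin n → ℝ) →
      (∀ i → p * exp (h i true) + q * exp (h i false) ≤ exp (c i)) →
      Eʳ n (λ s → exp (∑∉ K λ i → h i (lookup s i))) ≤ exp (∑∉ K c)
    Eʳ-exp-∑∉ [] h c hyp = ≤-reflexive (trans (+-identityʳ _) (*-identityˡ _))
    Eʳ-exp-∑∉ {suc n} (true ∷ K) h c hyp = ≤-respˡ-≈ (sym (trans (Eʳ-suc n _) (average _)))
      (Eʳ-exp-∑∉ K (h ∘ suc) (c ∘ suc) (hyp ∘ suc))
    Eʳ-exp-∑∉ {suc n} (false ∷ K) h c hyp = begin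
      Eʳ (suc n) (λ s → exp (h zero (lookup s zero) + ∑∉ K λ i → h (suc i) (lookup s (suc i))))
        ≈⟨ Eʳ-suc n _ ⟩
      p * Eʳ n (λ s → exp (h zero true + rest s)) + q * Eʳ n (λ s → exp (h zero false + rest s))
        ≈⟨ +-cong (*-congˡ (pull true)) (*-congˡ (pull false)) ⟩
      p * (exp (h zero true) * Eʳ n (exp ∘ rest)) + q * (exp (h zero false) * Eʳ n (exp ∘ rest))
        ≈⟨ solve 5 (λ p q x y e → p :* (x :* e) :+ q :* (y :* e) := (p :* x :+ q :* y) :* e) refl p q _ _ _ ⟩
      (p * exp (h zero true) + q * exp (h zero false)) * Eʳ n (exp ∘ rest)
        ≤⟨ *-mono-≤ (Eʳ-nonneg n λ s → proj₁ (0<exp _))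
             (proj₁ (0<exp _)) (hyp zero) (Eʳ-exp-∑∉ K (h ∘ suc) (c ∘ suc) (hyp ∘ suc)) ⟩
      exp (c zero) * exp (∑∉ K (c ∘ suc))
        ≈⟨ sym (exp-+ _ _) ⟩
      exp (c zero + ∑∉ K (c ∘ suc)) ∎
      where
      open ≤R
      rest : Subset n → ℝ
      rest s = ∑∉ K λ i → h (suc i) (lookup s i)
      pull : ∀ b → Eʳ n (λ s → exp (h zero b + rest s)) ≈ exp (h zero b) * Eʳ n (exp ∘ rest)
      pull b = trans (Eʳ-cong n λ s → exp-+ _ _) (Eʳ-* n _ _)

    dev : ∀ {n} → Subset n → Subset n → ℝ
    dev s K = fromℕ (∣ s ∩ K ∣) - fromℕ (∣ K ∣) * p

    dev-inside : ∀ {n} b (s K : Subset n) → dev (b ∷ s) (true ∷ K) ≈ bit b - p + dev s K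
    dev-inside true  s K = solve 3 (λ x y p → :1 :+ x :- (:1 :+ y) :* p := :1 :- p :+ (x :- y :* p)) refl _ _ p
    dev-inside false s K = solve 3 (λ x y p → x :- (:1 :+ y) :* p := :0 :- p :+ (x :- y :* p)) refl _ _ p

    dev-outside : ∀ {n} b (s K : Subset n) → dev (b ∷ s) (false ∷ K) ≡ dev s K
    dev-outside true  s K = ≡.refl
    dev-outside false s K = ≡.refl

    -- From 2(x + y)² ≤ 4x² + 4y² with x = 2tz and y = z², followed by z⁴ ≤ z². Every second-order
    -- term then carries z², whose mean is p(1 - p).
    exp-deviation : ∀ {r t z} → Bd z 1# → Bd (r * (2# * (t * z) + z * z)) ½ →
      exp (r * (2# * (t * z) + z * z)) ≤
        1# + r * (2# * (t * z) + z * z) + r * r * (fromℕ 16 * (t * t) + fromℕ 4) * (z * z)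
    exp-deviation {r} {t} {z} bz bu = ≤-trans (exp-quadratic bu)
      (diff⇒≤ (0≤x² r ⊗ (proj₁ 0<2 ⊗ 0≤x² (2# * (t * z) - z * z) ⊕ 0≤fromℕ 4 ⊗ (0≤x² z ⊗ (Bd⁻ bz ⊗ Bd⁺ bz))))
        (solve 3 (λ r t z → let w = :2 :* (t :* z) :+ z :* z ; u = r :* w ; v = :2 :* (t :* z) :- z :* z in
          :1 :+ u :+ r :* r :* (con (ℤ.+ 16) :* (t :* t) :+ con (ℤ.+ 4)) :* (z :* z) :- (:1 :+ u :+ :2 :* (u :* u))
          := r :* r :* (:2 :* (v :* v) :+ con (ℤ.+ 4) :* (z :* z :* ((:1 :- z) :* (:1 :+ z))))) refl r t z))

    -- The terms linear in t cancel, because an edge indicator has mean p.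
    Bernoulli-exp-square : ∀ {r t} → (∀ z → Bd z 1# → Bd (r * (2# * (t * z) + z * z)) ½) →
      p * exp (r * ((t + (1# - p)) * (t + (1# - p)))) + q * exp (r * ((t + (0# - p)) * (t + (0# - p)))) ≤
        exp (r * (t * t) + (r * (p * q) + r * r * (fromℕ 16 * (t * t) + fromℕ 4) * (p * q)))
    Bernoulli-exp-square {r} {t} small = begin
      p * exp (r * ((t + (1# - p)) * (t + (1# - p)))) + q * exp (r * ((t + (0# - p)) * (t + (0# - p))))
        ≈⟨ +-cong (*-congˡ (split (1# - p))) (*-congˡ (split (0# - p))) ⟩
      p * (exp (r * (t * t)) * exp (u (1# - p))) + q * (exp (r * (t * t)) * exp (u (0# - p)))
        ≈⟨ solve 5 (λ p q e x y → p :* (e :* x) :+ q :* (e :* y) := e :* (p :* x :+ q :* y)) refl p q _ _ _ ⟩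
      exp (r * (t * t)) * (p * exp (u (1# - p)) + q * exp (u (0# - p)))
        ≤⟨ *-monoˡ-≤ (proj₁ (0<exp _)) (+-mono-≤
             (*-monoˡ-≤ 0≤p (exp-deviation b₁ (small _ b₁))) (*-monoˡ-≤ 0≤q (exp-deviation b₀ (small _ b₀)))) ⟩
      exp (r * (t * t)) * (p * F (1# - p) + q * F (0# - p))
        ≈⟨ *-congˡ (solve 3 (λ p r t →
             let f z = :1 :+ r :* (:2 :* (t :* z) :+ z :* z) :+ r :* r :* (con (ℤ.+ 16) :* (t :* t) :+ con (ℤ.+ 4)) :* (z :* z)
                 q = :1 :- p in
             p :* f (:1 :- p) :+ q :* f (:0 :- p)
             := :1 :+ (r :* (p :* q) :+ r :* r :* (con (ℤ.+ 16) :* (t :* t) :+ con (ℤ.+ 4)) :* (p :* q))) refl p r t) ⟩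
      exp (r * (t * t)) * (1# + v)
        ≤⟨ *-monoˡ-≤ (proj₁ (0<exp _)) (1+x≤exp v) ⟩
      exp (r * (t * t)) * exp v
        ≈⟨ sym (exp-+ _ _) ⟩
      exp (r * (t * t) + v) ∎
      where
      open ≤R
      u F : ℝ → ℝ
      u z = r * (2# * (t * z) + z * z)
      F z = 1# + u z + r * r * (fromℕ 16 * (t * t) + fromℕ 4) * (z * z)
      v = r * (p * q) + r * r * (fromℕ 16 * (t * t) + fromℕ 4) * (p * q)
      split : ∀ z → exp (r * ((t + z) * (t + z))) ≈ exp (r * (t * t)) * exp (u z)
      split z = trans (exp-cong (solve 3 (λ r t z → r :* ((t :+ z) :* (t :+ z))
        := r :* (t :* t) :+ r :* (:2 :* (t :* z) :+ z :* z)) refl r t z)) (exp-+ _ _)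
      b₁ : Bd (1# - p) 1#
      b₁ = Bd-weaken (diff⇒≤ 0≤p (solve 1 (λ p → :1 :- (:1 :- p) := p) refl p)) (0≤x⇒Bd 0≤q)
      b₀ : Bd (0# - p) 1#
      b₀ = Bd-weaken p≤1 (Bd-resp (sym (+-identityˡ _)) refl (Bd-neg (0≤x⇒Bd 0≤p)))

    -- M bounds |t| plus the number of vertices of K still to be read, all through the recursion.
    -- The condition on l M keeps the weights at most 2l and the exponents small enough for
    -- `exp-quadratic`.
    module Chernoff (l M : ℝ) (0≤l : 0# ≤ l) (64lM≤1 : fromℕ 64 * (l * M) ≤ 1#) where

      -- All weights are at most 2l, so that one step raises them by at most 16 (2l)² = 64l²
      -- and adds at most l (1 + (64 + 16) lM) p q to the constant term.
      weight : ℕ → ℝ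
      weight j = l * (1# + fromℕ 64 * l * fromℕ j)

      -- Here j counts the vertices of K still to be read: at j = 0 only l t² is left, and each
      -- unread vertex contributes one `step`.
      bound : ℕ → ℝ → ℝ
      bound j t = weight j * (t * t) + l * (1# + fromℕ 80 * (l * M)) * fromℕ j * (p * q)

      step : ∀ j {t τ} → 0# ≤ τ → Bd t τ → τ + fromℕ (suc j) ≤ M →
        p * exp (bound j (t + (1# - p))) + q * exp (bound j (t + (0# - p))) ≤ exp (bound (suc j) t)
      step j {t} {τ} 0≤τ bt τ+j+1≤M = begin
        p * exp (bound j (t + (1# - p))) + q * exp (bound j (t + (0# - p)))
          ≈⟨ +-cong (*-congˡ (exp-+ _ _)) (*-congˡ (exp-+ _ _)) ⟩
        p * (exp (r * ((t + (1# - p)) * (t + (1# - p)))) * exp c) + q * (exp (r * ((t + (0# - p)) * (t + (0# - p)))) * exp c)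
          ≈⟨ solve 5 (λ p q x y e → p :* (x :* e) :+ q :* (y :* e) := (p :* x :+ q :* y) :* e) refl p q _ _ _ ⟩
        (p * exp (r * ((t + (1# - p)) * (t + (1# - p)))) + q * exp (r * ((t + (0# - p)) * (t + (0# - p))))) * exp c
          ≤⟨ *-mono-≤ (proj₁ (0<exp c)) (proj₁ (0<exp _)) (Bernoulli-exp-square small) ≤-refl ⟩
        exp (r * (t * t) + (r * (p * q) + r * r * (fromℕ 16 * (t * t) + fromℕ 4) * (p * q))) * exp c
          ≈⟨ sym (exp-+ _ _) ⟩
        exp (r * (t * t) + (r * (p * q) + r * r * (fromℕ 16 * (t * t) + fromℕ 4) * (p * q)) + c)
          ≤⟨ exp-mono exponent≤ ⟩
        exp (bound (suc j) t) ∎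
        where
        open ≤R
        J = fromℕ j
        r = weight j
        c = l * (1# + fromℕ 80 * (l * M)) * J * (p * q)
        0≤J = 0≤fromℕ j
        0≤slack : 0# ≤ M - (τ + (1# + J))
        0≤slack = ≤⇒0≤ τ+j+1≤M
        J+1≤M : 1# + J ≤ M
        J+1≤M = diff⇒≤ (0≤slack ⊕ 0≤τ) (solve 3 (λ M s J → M :- (:1 :+ J) := M :- (s :+ (:1 :+ J)) :+ s) refl M τ J)
        0≤r : 0# ≤ r
        0≤r = 0≤l ⊗ (0≤1 ⊕ 0≤fromℕ 64 ⊗ 0≤l ⊗ 0≤J)
        r≤2l : r ≤ 2# * l
        r≤2l = diff⇒≤ (0≤l ⊗ (≤⇒0≤ 64lM≤1 ⊕ 0≤fromℕ 64 ⊗ (0≤l ⊗ (≤⇒0≤ J+1≤M ⊕ 0≤1))))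
          (solve 3 (λ l M J → :2 :* l :- l :* (:1 :+ con (ℤ.+ 64) :* l :* J)
            := l :* (:1 :- con (ℤ.+ 64) :* (l :* M) :+ con (ℤ.+ 64) :* (l :* (M :- (:1 :+ J) :+ :1)))) refl l M J)
        pq≤1 : p * q ≤ 1#
        pq≤1 = diff⇒≤ (0≤q ⊕ 0≤x² p) (solve 1 (λ p → :1 :- p :* (:1 :- p) := :1 :- p :+ p :* p) refl p)
        rr≤4ll : r * r ≤ 2# * l * (2# * l)
        rr≤4ll = *-mono-≤ 0≤r (proj₁ 0<2 ⊗ 0≤l) r≤2l r≤2l
        -- The factor p q is given up here: 16 times the right side is 64l², exactly the increase
        -- from `weight j` to `weight (suc j)`.
        quadratic : r * r * (p * q) ≤ 2# * l * (2# * l)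
        quadratic = ≤-trans (*-mono-≤ (0≤p ⊗ 0≤q) (proj₁ 0<2 ⊗ 0≤l ⊗ (proj₁ 0<2 ⊗ 0≤l)) rr≤4ll pq≤1) (≤-reflexive (*-identityʳ _))
        linear : r + fromℕ 4 * (r * r) ≤ l * (1# + fromℕ 80 * (l * M))
        linear = diff⇒≤ (0≤fromℕ 64 ⊗ (0≤l ⊗ 0≤l) ⊗ (≤⇒0≤ J+1≤M ⊕ 0≤1) ⊕ 0≤fromℕ 4 ⊗ ≤⇒0≤ rr≤4ll
                          ⊕ 0≤fromℕ 16 ⊗ (0≤l ⊗ 0≤l) ⊗ (≤⇒0≤ J+1≤M ⊕ 0≤J))
          (solve 4 (λ l M J rr → l :* (:1 :+ con (ℤ.+ 80) :* (l :* M)) :- (l :* (:1 :+ con (ℤ.+ 64) :* l :* J) :+ con (ℤ.+ 4) :* rr)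
            := con (ℤ.+ 64) :* (l :* l) :* (M :- (:1 :+ J) :+ :1) :+ con (ℤ.+ 4) :* (:2 :* l :* (:2 :* l) :- rr)
               :+ con (ℤ.+ 16) :* (l :* l) :* (M :- (:1 :+ J) :+ J)) refl l M J (r * r))
        exponent≤ : r * (t * t) + (r * (p * q) + r * r * (fromℕ 16 * (t * t) + fromℕ 4) * (p * q)) + c ≤ bound (suc j) t
        exponent≤ = diff⇒≤ (0≤fromℕ 16 ⊗ 0≤x² t ⊗ ≤⇒0≤ quadratic ⊕ ≤⇒0≤ linear ⊗ (0≤p ⊗ 0≤q))
          (solve 6 (λ l w M J t d →
            let r = l :* (:1 :+ con (ℤ.+ 64) :* l :* J) in
            l :* (:1 :+ con (ℤ.+ 64) :* l :* (:1 :+ J)) :* (t :* t) :+ w :* (:1 :+ J) :* d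
            :- (r :* (t :* t) :+ (r :* d :+ r :* r :* (con (ℤ.+ 16) :* (t :* t) :+ con (ℤ.+ 4)) :* d) :+ w :* J :* d)
            := con (ℤ.+ 16) :* (t :* t) :* (:2 :* l :* (:2 :* l) :- r :* r :* d) :+ (w :- (r :+ con (ℤ.+ 4) :* (r :* r))) :* d)
            refl l (l * (1# + fromℕ 80 * (l * M))) M J t (p * q))
        -- |2tz + z²| ≤ 2τ + 1 ≤ 2M and r ≤ 2l, so the exponent is at most 4lM, well below one half.
        small : ∀ z → Bd z 1# → Bd (r * (2# * (t * z) + z * z)) ½
        small z bz = Bd-weaken r[2τ+1]≤½ (Bd-resp refl (*-congˡ (solve 1 (λ s → :2 :* (s :* :1) :+ :1 :* :1 := :2 :* s :+ :1) refl τ))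
          (Bd-* (0≤x⇒Bd 0≤r) (Bd-+ (Bd-* (0≤x⇒Bd (proj₁ 0<2)) (Bd-* bt bz)) (Bd-* bz bz))))
          where
          2τ+1≤2M : 2# * τ + 1# ≤ 2# * M
          2τ+1≤2M = diff⇒≤ (proj₁ 0<2 ⊗ 0≤slack ⊕ (proj₁ 0<2 ⊗ 0≤J ⊕ 0≤1))
            (solve 3 (λ M s J → :2 :* M :- (:2 :* s :+ :1) := :2 :* (M :- (s :+ (:1 :+ J))) :+ (:2 :* J :+ :1)) refl M τ J)
          0≤M : 0# ≤ M
          0≤M = ≤-trans (0≤1 ⊕ 0≤J) J+1≤M
          r[2τ+1]≤½ : r * (2# * τ + 1#) ≤ ½
          r[2τ+1]≤½ = ≤-trans (*-mono-≤ (proj₁ 0<2 ⊗ 0≤τ ⊕ 0≤1) (proj₁ 0<2 ⊗ 0≤l) r≤2l 2τ+1≤2M)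
            (*-cancelˡ-≤ 0<2 (≤-trans (diff⇒≤ (≤⇒0≤ 64lM≤1 ⊕ 0≤fromℕ 56 ⊗ (0≤l ⊗ 0≤M))
               (solve 2 (λ l M → :1 :- :2 :* (:2 :* l :* (:2 :* M)) := :1 :- con (ℤ.+ 64) :* (l :* M) :+ con (ℤ.+ 56) :* (l :* M)) refl l M))
               (≤-reflexive (sym (⁻¹-inverseʳ 0<2)))))

      bound-zero : ∀ t → bound 0 t ≈ l * (t * t)
      bound-zero t = solve 4 (λ l t w d → l :* (:1 :+ con (ℤ.+ 64) :* l :* :0) :* (t :* t) :+ w :* :0 :* d := l :* (t :* t))
        refl l t (l * (1# + fromℕ 80 * (l * M))) (p * q)

      absorb-vertex : ∀ {n} (K : Subset n) {τ} → τ + fromℕ (suc ∣ K ∣) ≤ M → τ + 1# + fromℕ (∣ K ∣) ≤ M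
      absorb-vertex K = ≤-respˡ-≈ (sym (+-assoc _ _ _))

      Bd-shift : ∀ {t τ} b → Bd t τ → Bd (t + (bit b - p)) (τ + 1#)
      Bd-shift true  bt = Bd-+ bt (Bd-weaken (diff⇒≤ 0≤p (solve 1 (λ p → :1 :- (:1 :- p) := p) refl p)) (0≤x⇒Bd 0≤q))
      Bd-shift false bt = Bd-+ bt (Bd-weaken p≤1 (Bd-resp (sym (+-identityˡ _)) refl (Bd-neg (0≤x⇒Bd 0≤p))))

      energy : ∀ {n} → ℝ → Subset n → Subset n → ℝ
      energy t K s = l * ((t + dev s K) * (t + dev s K))

      energy-inside : ∀ {n} t b (s K : Subset n) → energy t (true ∷ K) (b ∷ s) ≈ energy (t + (bit b - p)) K s
      energy-inside t b s K = *-congˡ (*-cong eq eq)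
        where eq = trans (+-congˡ (dev-inside b s K)) (sym (+-assoc _ _ _))

      energy-outside : ∀ {n} t b (s K : Subset n) → energy t (false ∷ K) (b ∷ s) ≡ energy t K s
      energy-outside t b s K = ≡.cong (λ d → l * ((t + d) * (t + d))) (dev-outside b s K)

      -- The case of a vertex outside K whose own row holds its remaining edges to K: the row is
      -- read bit by bit, and each bit in K shifts the offset.
      Eʳ-exp-energy : ∀ {n} (K : Subset n) {t τ} → 0# ≤ τ → Bd t τ → τ + fromℕ (∣ K ∣) ≤ M →
        Eʳ n (λ s → exp (energy t K s)) ≤ exp (bound ∣ K ∣ t)
      Eʳ-exp-energy [] {t} 0≤τ bt _ = ≤-reflexive (trans (+-identityʳ _) (trans (*-identityˡ _)
        (exp-cong (trans (solve 3 (λ l t p → l :* ((t :+ (:0 :- :0 :* p)) :* (t :+ (:0 :- :0 :* p))) := l :* (t :* t)) refl l t p)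
          (sym (bound-zero t))))))
      Eʳ-exp-energy {suc n} (true ∷ K) {t} {τ} 0≤τ bt le = begin
        Eʳ (suc n) (λ s → exp (energy t (true ∷ K) s))
          ≈⟨ Eʳ-suc n _ ⟩
        p * Eʳ n (λ s → exp (energy t (true ∷ K) (true ∷ s))) + q * Eʳ n (λ s → exp (energy t (true ∷ K) (false ∷ s)))
          ≤⟨ +-mono-≤ (*-monoˡ-≤ 0≤p (branch true)) (*-monoˡ-≤ 0≤q (branch false)) ⟩
        p * exp (bound ∣ K ∣ (t + (1# - p))) + q * exp (bound ∣ K ∣ (t + (0# - p)))
          ≤⟨ step ∣ K ∣ 0≤τ bt le ⟩
        exp (bound (suc ∣ K ∣) t) ∎
        where
        open ≤R
        branch : ∀ b → Eʳ n (λ s → exp (energy t (true ∷ K) (b ∷ s))) ≤ exp (bound ∣ K ∣ (t + (bit b - p)))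
        branch b = ≤-respˡ-≈ (Eʳ-cong n λ s → exp-cong (sym (energy-inside t b s K)))
          (Eʳ-exp-energy K (0≤τ ⊕ 0≤1) (Bd-shift b bt) (absorb-vertex K le))
      Eʳ-exp-energy {suc n} (false ∷ K) {t} 0≤τ bt le = ≤-respˡ-≈
        (sym (trans (Eʳ-suc n _) (trans (+-cong (*-congˡ (branch true)) (*-congˡ (branch false))) (average _))))
        (Eʳ-exp-energy K 0≤τ bt le)
        where
        branch : ∀ b → Eʳ n (λ s → exp (energy t (false ∷ K) (b ∷ s))) ≈ Eʳ n (λ s → exp (energy t K s))
        branch b = Eʳ-cong n λ s → exp-cong (reflexive (energy-outside t b s K))

      -- The offsets t absorb the edges to the vertices of K already revealed.
      E-exp-energy : ∀ {n} (K : Subset n) {t : Fin n → ℝ} {τ} → 0# ≤ τ → (∀ i → Bd (t i) τ) → τ + fromℕ (∣ K ∣) ≤ M →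
        E n (λ G → exp (∑∉ K λ i → energy (t i) K (neighbours G i))) ≤ exp (∑∉ K λ i → bound ∣ K ∣ (t i))
      E-exp-energy [] 0≤τ bt _ = ≤-reflexive (trans (+-identityʳ _) (*-identityˡ _))
      E-exp-energy {suc n} (true ∷ K) {t} {τ} 0≤τ bt le = begin
        E (suc n) (λ G → exp (∑∉ K λ i → energy (t (suc i)) (true ∷ K) (neighbours G (suc i))))
          ≈⟨ E-suc n _ ⟩
        Eʳ n (λ s → E n λ G → exp (∑∉ K λ i → energy (t (suc i)) (true ∷ K) (lookup s i ∷ neighbours G i)))
          ≈⟨ Eʳ-cong n (λ s → E-cong n λ G → exp-cong (∑∉-cong K λ i → energy-inside (t (suc i)) (lookup s i) (neighbours G i) K)) ⟩
        Eʳ n (λ s → E n λ G → exp (∑∉ K λ i → energy (t (suc i) + (bit (lookup s i) - p)) K (neighbours G i)))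
          -- For a fixed row s the induction hypothesis applies with offsets shifted by s. Only
          -- afterwards is the row averaged, where its bits are independent and `step` handles each
          -- i.
          ≤⟨ Eʳ-mono n (λ s → E-exp-energy K (0≤τ ⊕ 0≤1) (λ i → Bd-shift (lookup s i) (bt (suc i))) (absorb-vertex K le)) ⟩
        Eʳ n (λ s → exp (∑∉ K λ i → bound ∣ K ∣ (t (suc i) + (bit (lookup s i) - p))))
          ≤⟨ Eʳ-exp-∑∉ K (λ i b → bound ∣ K ∣ (t (suc i) + (bit b - p))) _ (λ i → step ∣ K ∣ 0≤τ (bt (suc i)) le) ⟩
        exp (∑∉ K λ i → bound (suc ∣ K ∣) (t (suc i))) ∎
        where open ≤R
      E-exp-energy {suc n} (false ∷ K) {t} {τ} 0≤τ bt le = begin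
        E (suc n) (λ G → exp (energy (t zero) (false ∷ K) (neighbours G zero)
                              + ∑∉ K λ i → energy (t (suc i)) (false ∷ K) (neighbours G (suc i))))
          ≈⟨ E-suc n _ ⟩
        Eʳ n (λ s → E n λ G → exp (energy (t zero) (false ∷ K) (false ∷ tabulate (lookup s))
                                   + ∑∉ K λ i → energy (t (suc i)) (false ∷ K) (lookup s i ∷ neighbours G i)))
          -- The new vertex is outside K, so its edges to the other i do not count. Its own energy
          -- depends on s alone and the rest on G alone, and the expectation factors.
          ≈⟨ Eʳ-cong n (λ s → E-cong n λ G → trans (exp-cong (+-cong (own s) (others s G))) (exp-+ _ _)) ⟩
        Eʳ n (λ s → E n λ G → exp (energy (t zero) K s) * exp (rest G))
          ≈⟨ Eʳ-cong n (λ s → trans (E-* n _ _) (*-comm _ _)) ⟩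
        Eʳ n (λ s → E n (exp ∘ rest) * exp (energy (t zero) K s))
          ≈⟨ Eʳ-* n _ _ ⟩
        E n (exp ∘ rest) * Eʳ n (λ s → exp (energy (t zero) K s))
          ≤⟨ *-mono-≤ (Eʳ-nonneg n λ s → proj₁ (0<exp _)) (proj₁ (0<exp _))
               (E-exp-energy K 0≤τ (bt ∘ suc) le) (Eʳ-exp-energy K 0≤τ (bt zero) le) ⟩
        exp (∑∉ K λ i → bound ∣ K ∣ (t (suc i))) * exp (bound ∣ K ∣ (t zero))
          ≈⟨ trans (*-comm _ _) (sym (exp-+ _ _)) ⟩
        exp (bound ∣ K ∣ (t zero) + ∑∉ K λ i → bound ∣ K ∣ (t (suc i))) ∎
        where
        open ≤R
        rest : Graph n → ℝ
        rest G = ∑∉ K λ i → energy (t (suc i)) K (neighbours G i)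
        own : ∀ s → energy (t zero) (false ∷ K) (false ∷ tabulate (lookup s)) ≈ energy (t zero) K s
        own s = reflexive (≡.cong (energy (t zero) K) (tabulate∘lookup s))
        others : ∀ s G → ∑∉ K (λ i → energy (t (suc i)) (false ∷ K) (lookup s i ∷ neighbours G i)) ≈ rest G
        others s G = ∑∉-cong K λ i → reflexive (energy-outside (t (suc i)) (lookup s i) (neighbours G i) K)

    -- Markov's inequality and the union bound over k-sets

    Pr-mono : ∀ n {A B : Graph n → Set} → (∀ G → A G → B G) → Pr n p A ≤ Pr n p B
    Pr-mono n {A} {B} A⇒B = ∑-mono (graphs n) λ G → pointwise (mass-nonneg G) (em {A G}) (em {B G}) (A⇒B G)
      where
      pointwise : ∀ {m} {A B : Set} → 0# ≤ m → (a : Dec A) (b : Dec B) → (A → B) → 𝟙 a m ≤ 𝟙 b m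
      pointwise 0≤m (yes a) (yes _) f = ≤-refl
      pointwise 0≤m (yes a) (no ¬b) f = ⊥-elim (¬b (f a))
      pointwise 0≤m (no _)  b       f = 𝟙-nonneg b 0≤m

    -- Markov's inequality: Z dominates the indicator of failure.
    Pr-≥ : ∀ n {A : Graph n → Set} (Z : Graph n → ℝ) → (∀ G → 0# ≤ Z G) → (∀ G → ¬ A G → 1# ≤ Z G) →
           1# - E n Z ≤ Pr n p A
    Pr-≥ n {A} Z 0≤Z hyp = diff⇒≤ (≤⇒0≤ (≤-resp₂ (E-1 n) (∑-+ (graphs n) _ _)
        (∑-mono (graphs n) λ G → pointwise (mass-nonneg G) (0≤Z G) (em {A G}) (hyp G))))
      (solve 2 (λ a z → a :- (:1 :- z) := a :+ z :- :1) refl _ _)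
      where
      pointwise : ∀ {m z} {A : Set} → 0# ≤ m → 0# ≤ z → (a : Dec A) → (¬ A → 1# ≤ z) → m * 1# ≤ 𝟙 a m + m * z
      pointwise {m} {z} 0≤m 0≤z (yes _) f = diff⇒≤ (0≤m ⊗ 0≤z) (solve 2 (λ m z → m :+ m :* z :- m :* :1 := m :* z) refl m z)
      pointwise 0≤m 0≤z (no ¬a) f = ≤-respʳ-≈ (sym (+-identityˡ _)) (*-monoˡ-≤ 0≤m (f ¬a))

    deviation : ∀ {n} → ℕ → Graph n → Subset n → ℝ
    deviation k G K = ∑∈ (∁ K) (λ i → (fromℕ (X G K i) - fromℕ k * p) ^ 2)

    Pr-certain : ∀ n {A : Graph n → Set} → (∀ G → A G) → 1# ≤ Pr n p A
    Pr-certain n {A} all = ≤-respˡ-≈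
      (trans (+-congˡ (-‿cong (trans (E-cong n λ _ → sym (zeroˡ 0#)) (trans (E-* n 0# _) (zeroˡ _)))))
        (solve 0 (:1 :- :0 := :1) refl))
      (Pr-≥ n {A} (λ _ → 0#) (λ _ → ≤-refl) (λ G ¬a → ⊥-elim (¬a (all G))))

    -- Crude on purpose: it only serves to show that some error term is admissible for each n. The
    -- cross term -2xy is dropped and X_i ≤ n is used.
    deviation-≤ : ∀ {n} k (G : Graph n) K → deviation k G K ≤ fromℕ n * (fromℕ n * fromℕ n + fromℕ k * p * (fromℕ k * p))
    deviation-≤ {n} k G K = ≤-respˡ-≈ (sym (∑∈-∁ K _)) (∑∉-≤ K (0≤x² _ ⊕ 0≤x² _) λ i →
      let x = fromℕ (X G K i)
          y = fromℕ k * p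
          N = fromℕ n
          0≤x = 0≤fromℕ (X G K i)
          x≤N = fromℕ-mono-≤ (∣p∣≤n (neighbours G i ∩ K))
          0≤N = 0≤fromℕ n
      in diff⇒≤ (≤⇒0≤ x≤N ⊗ 0≤N ⊕ 0≤x ⊗ ≤⇒0≤ x≤N ⊕ proj₁ 0<2 ⊗ (0≤x ⊗ (0≤fromℕ k ⊗ 0≤p)))
           (solve 3 (λ x y n → n :* n :+ y :* y :- (x :- y) :* ((x :- y) :* :1)
             := (n :- x) :* n :+ x :* (n :- x) :+ :2 :* (x :* y)) refl x y N))

    Pr-deviation : ∀ n k l M T → 0# ≤ l → fromℕ 64 * (l * M) ≤ 1# → fromℕ k ≤ M →
      1# - fromℕ n ^ k * exp ((fromℕ n - fromℕ k) * (l * (1# + fromℕ 80 * (l * M)) * fromℕ k * (p * q)) - l * T)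
        ≤ Pr n p (λ G → (K : Subset n) → ∣ K ∣ ≡ k → deviation k G K ≤ T)
    Pr-deviation n k l M T 0≤l 64lM≤1 k≤M =
      ≤-trans (+-monoʳ-≤ 1# (neg-mono-≤ EZ≤)) (Pr-≥ n {A} Z Z-nonneg Z≥1)
      where
      open ≤R
      open Chernoff l M 0≤l 64lM≤1
      c = l * (1# + fromℕ 80 * (l * M)) * fromℕ k * (p * q)
      B = exp ((fromℕ n - fromℕ k) * c - l * T)
      A : Graph n → Set
      A G = (K : Subset n) → ∣ K ∣ ≡ k → deviation k G K ≤ T
      ζ : Subset n → Graph n → ℝ
      ζ K G = exp (l * deviation k G K - l * T)
      -- If the event fails, some k-set gives a term of at least 1, and no term is negative.
      Z : Graph n → ℝ
      Z G = ∑ (subsets n) λ K → 𝟙 (∣ K ∣ ℕ.≟ k) (ζ K G)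
      Z-nonneg : ∀ G → 0# ≤ Z G
      Z-nonneg G = ∑-nonneg (subsets n) λ K → 𝟙-nonneg (∣ K ∣ ℕ.≟ k) (proj₁ (0<exp _))
      Z≥1 : ∀ G → ¬ A G → 1# ≤ Z G
      Z≥1 G ¬A with em {∃ λ K → ∣ K ∣ ≡ k × ¬ (deviation k G K ≤ T)}
      ... | no none = ⊥-elim (¬A λ K ∣K∣≡k → ≮⇒≥ λ T<dev → none (K , ∣K∣≡k , <⇒≱ T<dev))
      ... | yes (K , ∣K∣≡k , dev≰T) = begin
        1#                          ≈⟨ sym exp-0 ⟩
        exp 0#                      ≤⟨ exp-mono (≤⇒0≤ (*-monoˡ-≤ 0≤l (proj₁ (≰⇒> dev≰T)))) ⟩
        ζ K G                       ≈⟨ sym (𝟙-yes (∣ K ∣ ℕ.≟ k) ∣K∣≡k) ⟩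
        𝟙 (∣ K ∣ ℕ.≟ k) (ζ K G)     ≤⟨ ≤∑-subsets K (λ K → 𝟙 (∣ K ∣ ℕ.≟ k) (ζ K G)) (λ K → 𝟙-nonneg (∣ K ∣ ℕ.≟ k) (proj₁ (0<exp _))) ⟩
        Z G                         ∎
      l*deviation : ∀ G K → l * deviation ∣ K ∣ G K ≈ ∑∉ K (λ i → energy 0# K (neighbours G i))
      l*deviation G K = trans (*-congˡ (∑∈-∁ K _)) (trans (sym (∑∉-* K l _)) (∑∉-cong K λ i →
        *-congˡ (solve 1 (λ d → d :* (d :* :1) := (:0 :+ d) :* (:0 :+ d)) refl (dev (neighbours G i) K))))
      Eζ≤ : ∀ K → ∣ K ∣ ≡ k → E n (ζ K) ≤ B
      Eζ≤ K ≡.refl = begin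
        E n (ζ K)
          ≈⟨ E-cong n (λ G → trans (exp-+ _ _) (trans (*-comm _ _) (*-congˡ (exp-cong (l*deviation G K))))) ⟩
        E n (λ G → exp (- (l * T)) * exp (∑∉ K λ i → energy 0# K (neighbours G i)))
          ≈⟨ E-* n _ _ ⟩
        exp (- (l * T)) * E n (λ G → exp (∑∉ K λ i → energy 0# K (neighbours G i)))
          ≤⟨ *-monoˡ-≤ (proj₁ (0<exp _)) (E-exp-energy K ≤-refl (λ i → 0≤x⇒Bd ≤-refl) (≤-respˡ-≈ (sym (+-identityˡ _)) k≤M)) ⟩
        exp (- (l * T)) * exp (∑∉ K λ i → bound k 0#)
          ≈⟨ trans (*-comm _ _) (sym (exp-+ _ _)) ⟩
        exp (∑∉ K (λ i → bound k 0#) - l * T)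
          -- At offset 0 the weighted square vanishes, and each of the n - k vertices outside K
          -- contributes the constant term c.
          ≈⟨ exp-cong (+-congʳ (trans (∑∉-const K _) (*-congˡ (trans (+-congʳ (trans (*-congˡ (zeroˡ 0#)) (zeroʳ _))) (+-identityˡ c))))) ⟩
        B ∎
      EZ≤ : E n Z ≤ fromℕ n ^ k * B
      EZ≤ = begin
        E n Z
          ≈⟨ ∑-cong (graphs n) (λ G → sym (∑-* (mass p G) (subsets n) _)) ⟩
        ∑ (graphs n) (λ G → ∑ (subsets n) λ K → mass p G * 𝟙 (∣ K ∣ ℕ.≟ k) (ζ K G))
          ≈⟨ ∑-swap (graphs n) (subsets n) _ ⟩
        ∑ (subsets n) (λ K → ∑ (graphs n) λ G → mass p G * 𝟙 (∣ K ∣ ℕ.≟ k) (ζ K G))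
          ≈⟨ ∑-cong (subsets n) (λ K → trans (∑-cong (graphs n) λ G → 𝟙-* (∣ K ∣ ℕ.≟ k) (mass p G) (ζ K G)) (𝟙-∑ (∣ K ∣ ℕ.≟ k) (graphs n) _)) ⟩
        ∑ (subsets n) (λ K → 𝟙 (∣ K ∣ ℕ.≟ k) (E n (ζ K)))
          ≤⟨ ∑-mono (subsets n) (λ K → 𝟙-mono (∣ K ∣ ℕ.≟ k) (Eζ≤ K)) ⟩
        ∑ (subsets n) (λ K → 𝟙 (∣ K ∣ ℕ.≟ k) B)
          ≤⟨ ∑-subsets-of-size n k (proj₁ (0<exp _)) ⟩
        fromℕ n ^ k * B ∎

  -- Asymptotics

  x²≤y²⇒x≤y : ∀ {x y} → 0# ≤ y → x * x ≤ y * y → x ≤ y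
  x²≤y²⇒x≤y {x} {y} 0≤y x²≤y² with em {x ≤ y}
  ... | yes x≤y = x≤y
  ... | no  x≰y = let y<x = ≰⇒> x≰y in ⊥-elim (<⇒≱
          (diff⇒< (*-pos (<⇒0< y<x) (+-pos (≤-<-trans 0≤y y<x) 0≤y))
            (solve 2 (λ x y → x :* x :- y :* y := (x :- y) :* (x :+ y)) refl x y)) x²≤y²)

  -- The supremum s of the lower bounds. P may fail at s itself but holds just above: otherwise, P
  -- being closed upwards, s + η would be a lower bound.
  infimum : ∀ (P : ℝ → Set) → (∃ λ e → 0# ≤ e × P e) → (∀ {x y} → x ≤ y → P x → P y) →
    ∃ λ s → 0# ≤ s × (∀ e → 0# ≤ e → P e → s ≤ e) × (∀ η → 0# < η → P (s + η))
  infimum P (e₀ , 0≤e₀ , Pe₀) upward = s , 0≤s , s≤ , above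
    where
    Lower : ℝ → Set
    Lower x = ∀ e → 0# ≤ e → P e → x ≤ e
    S = supremum Lower (0# , λ _ 0≤e _ → 0≤e) (e₀ , λ x x-lower → x-lower e₀ 0≤e₀ Pe₀)
    s = proj₁ S
    0≤s : 0# ≤ s
    0≤s = proj₁ (proj₂ S) 0# (λ _ 0≤e _ → 0≤e)
    s≤ : ∀ e → 0# ≤ e → P e → s ≤ e
    s≤ e 0≤e Pe = proj₂ (proj₂ S) e λ x x-lower → x-lower e 0≤e Pe
    above : ∀ η → 0# < η → P (s + η)
    above η 0<η with em {P (s + η)}
    ... | yes P[s+η] = P[s+η]
    ... | no ¬P[s+η] = ⊥-elim (<⇒≱ 0<η (diff⇒≤ (≤⇒0≤ s+η≤s) (solve 2 (λ s h → :0 :- h := s :- (s :+ h)) refl s η)))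
      where
      s+η≤s : s + η ≤ s
      s+η≤s = proj₁ (proj₂ S) (s + η) λ e _ Pe → ≮⇒≥ λ e<s+η → ¬P[s+η] (upward (proj₁ e<s+η) Pe)

  0<ln2 : 0# < ln 2#
  0<ln2 = exp-reflects-≤ (≤-resp₂ (sym exp-0) (sym (exp-ln 0<2)) (diff⇒≤ 0≤1 (solve 0 (:2 :- :1 := :1) refl))) ,
    λ 0≈ln2 → 0≉1 (trans (sym (-‿inverseʳ 1#)) (trans (+-congʳ
      (trans (sym exp-0) (trans (exp-cong 0≈ln2) (exp-ln 0<2)))) (solve 0 (:2 :- :1 := :1) refl)))

  ln2≤1 : ln 2# ≤ 1#
  ln2≤1 = exp-reflects-≤ (≤-respˡ-≈ (trans (solve 0 (:1 :+ :1 := :2) refl) (sym (exp-ln 0<2))) (1+x≤exp 1#))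

  1≤log₂ : ∀ n → 2 ℕ.≤ n → 1# ≤ log₂ (fromℕ n)
  1≤log₂ (suc n) 2≤n = *≤⇒≤/ 0<ln2 (≤-respˡ-≈ (sym (*-identityʳ _))
    (exp-reflects-≤ (≤-resp₂ (sym (exp-ln 0<2)) (sym (exp-ln (0<fromℕ n))) (fromℕ-mono-≤ 2≤n))))

  -- Since ln 2 ≤ 1. The union bound produces natural logarithms, the required probability is stated
  -- in base 2.
  ln≤log₂ : ∀ n → 2 ℕ.≤ n → ln (fromℕ n) ≤ log₂ (fromℕ n)
  ln≤log₂ n 2≤n = ≤-resp₂ (*-/-cancel 0<ln2) (*-identityˡ _)
    (*-mono-≤ (≤-trans 0≤1 (1≤log₂ n 2≤n)) 0≤1 ln2≤1 ≤-refl)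

  -- Multiplying e^{kℓ}, which bounds the number of k-sets, by the Chernoff bound leaves e^{-2kL}.
  exponent-≤ : ∀ {N k ℓ L l m p q h} → ℓ ≤ L → 0# ≤ k → 0# ≤ l → 0# ≤ m → 0# ≤ N → 0# ≤ p → 0# ≤ q →
    fromℕ 3 * (k * L) ≤ l * (N * k * p * q) * h → fromℕ 80 * m ≤ h →
    k * ℓ + ((N - k) * (l * (1# + fromℕ 80 * m) * k * (p * q)) - l * ((N - k) * k * p * q + (h + h) * (N * k * p * q)))
      ≤ - (2# * k * L)
  exponent-≤ {N} {k} {ℓ} {L} {l} {m} {p} {q} {h} ℓ≤L 0≤k 0≤l 0≤m 0≤N 0≤p 0≤q main 80m≤h = diff⇒≤
    -- Of the three k L in `main`, one pays for e^(kℓ) and two form the right-hand side. The last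
    -- summand is the slack left by using N instead of N - k in front of 80 m.
    (0≤k ⊗ ≤⇒0≤ ℓ≤L ⊕ ≤⇒0≤ main ⊕ 0≤l ⊗ (0≤N ⊗ 0≤k ⊗ 0≤p ⊗ 0≤q) ⊗ ≤⇒0≤ 80m≤h
      ⊕ 0≤fromℕ 80 ⊗ 0≤m ⊗ 0≤l ⊗ (0≤k ⊗ 0≤k ⊗ (0≤p ⊗ 0≤q)))
    (solve 9 (λ N k ℓ L l m p q h →
       :- (:2 :* k :* L) :- (k :* ℓ :+ ((N :- k) :* (l :* (:1 :+ con (ℤ.+ 80) :* m) :* k :* (p :* q))
         :- l :* ((N :- k) :* k :* p :* q :+ (h :+ h) :* (N :* k :* p :* q))))
       := k :* (L :- ℓ) :+ (l :* (N :* k :* p :* q) :* h :- con (ℤ.+ 3) :* (k :* L))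
          :+ l :* (N :* k :* p :* q) :* (h :- con (ℤ.+ 80) :* m)
          :+ con (ℤ.+ 80) :* m :* l :* (k :* k :* (p :* q))) refl N k ℓ L l m p q h)

  module Asymptotics
    (c C : ℝ) (c<1 : c < 1#) (0<C : 0# < C) (w : ℕ → ℝ)
    (w-bounds : ∀ n → 1 ℕ.≤ n → 0# < w n × w n < c * fromℕ n)
    (log⁴≪w : (λ n → log₂ (fromℕ n) ^ 4) ≪ w)
    (k : ℕ → ℕ) (k≈C√w : ∀ n → 1 ℕ.≤ n → Within 1# (fromℕ (k n)) (C * √ (w n)))
    where

    p : ℕ → ℝ
    p n = w n / fromℕ n

    scale : ℕ → ℝ
    scale n = fromℕ n * fromℕ (k n) * p n * (1# - p n)

    Good : ∀ n → ℝ → Set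
    Good n e = 1# - exp (- (fromℕ 2 * fromℕ (k n) * log₂ (fromℕ n)))
      ≤ Pr n (p n) (λ G → (K : Subset n) → ∣ K ∣ ≡ k n →
          ∑∈ (∁ K) (λ i → (fromℕ (X G K i) - fromℕ (k n) * p n) ^ 2)
            ≤ (fromℕ n - fromℕ (k n)) * fromℕ (k n) * p n * (1# - p n) + e)

    0<1-c : 0# < 1# - c
    0<1-c = <⇒0< c<1

    0<n : ∀ n → 1 ℕ.≤ n → 0# < fromℕ n
    0<n (suc n) _ = 0<fromℕ n

    np≈w : ∀ n → 1 ℕ.≤ n → fromℕ n * p n ≈ w n
    np≈w n 1≤n = *-/-cancel (0<n n 1≤n)

    0<p : ∀ n → 1 ℕ.≤ n → 0# < p n
    0<p n 1≤n = /-pos (proj₁ (w-bounds n 1≤n)) (0<n n 1≤n)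

    p≤c : ∀ n → 1 ℕ.≤ n → p n ≤ c
    p≤c n 1≤n = ≤*⇒/≤ (0<n n 1≤n) (≤-respʳ-≈ (*-comm _ _) (proj₁ (proj₂ (w-bounds n 1≤n))))

    p≤1 : ∀ n → 1 ℕ.≤ n → p n ≤ 1#
    p≤1 n 1≤n = ≤-trans (p≤c n 1≤n) (proj₁ c<1)

    Good-upward : ∀ n → 1 ℕ.≤ n → ∀ {x y} → x ≤ y → Good n x → Good n y
    Good-upward n 1≤n x≤y good = ≤-trans good
      (Pr-mono n λ G all K ∣K∣≡k → ≤-trans (all K ∣K∣≡k) (+-monoʳ-≤ _ x≤y))
      where open RandomGraph (p n) (proj₁ (0<p n 1≤n)) (p≤1 n 1≤n)

    Good-inhabited : ∀ n → 1 ℕ.≤ n → ∃ λ e → 0# ≤ e × Good n e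
    Good-inhabited n 1≤n =
      let b , 0≤b , mean-bd = ∃Bd ((fromℕ n - fromℕ (k n)) * fromℕ (k n) * p n * (1# - p n))
          worst = fromℕ n * (fromℕ n * fromℕ n + fromℕ (k n) * p n * (fromℕ (k n) * p n))
      in worst + b , 0≤fromℕ n ⊗ (0≤x² _ ⊕ 0≤x² _) ⊕ 0≤b ,
         ≤-trans (diff⇒≤ (proj₁ (0<exp _)) (solve 1 (λ e → :1 :- (:1 :- e) := e) refl _))
           (Pr-certain n λ G K _ → ≤-trans (deviation-≤ (k n) G K)
             (diff⇒≤ (Bd⁺ mean-bd) (solve 3 (λ m b v → m :+ (v :+ b) :- v := b :+ m) refl _ _ _)))
      where open RandomGraph (p n) (proj₁ (0<p n 1≤n)) (p≤1 n 1≤n)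

    log⁴≤ : ∀ η → 0# < η → ∃ λ N → ∀ n → 2 ℕ.+ N ℕ.≤ n → log₂ (fromℕ n) ^ 4 ≤ w n * η
    log⁴≤ η 0<η = let N , close = log⁴≪w η 0<η in N , λ n 2+N≤n → /≤⇒≤* (proj₁ (w-bounds n (ℕ.≤-trans (ℕ.s≤s ℕ.z≤n) 2+N≤n)))
      (≤-respˡ-≈ (solve 1 (λ x → x :- :0 := x) refl _)
        (proj₁ (proj₁ (close n (ℕ.≤-trans (ℕ.m≤n+m N 2) 2+N≤n)))))

    1≤^ : ∀ {x} → 1# ≤ x → ∀ j → 1# ≤ x ^ j
    1≤^ 1≤x zero    = ≤-refl
    1≤^ 1≤x (suc j) = ≤-trans (≤-reflexive (sym (*-identityˡ 1#))) (*-mono-≤ 0≤1 (≤-trans 0≤1 1≤x) 1≤x (1≤^ 1≤x j))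

    -- For n ≥ 2 the fourth power of log₂ n is at least 1, so `log⁴≤` with η = 1/B² gives w n ≥ B².
    √w-large : ∀ B → 0# < B → ∃ λ N → ∀ n → 2 ℕ.+ N ℕ.≤ n → B ≤ √ (w n)
    √w-large B 0<B = let N , bound = log⁴≤ ((B * B) ⁻¹) (⁻¹-pos (*-pos 0<B 0<B)) in N , λ n 2+N≤n →
      let 2≤n = ℕ.≤-trans (ℕ.m≤m+n 2 N) 2+N≤n
          0≤√ , √√≈w = √-spec (proj₁ (w-bounds n (ℕ.≤-trans (ℕ.s≤s ℕ.z≤n) 2≤n)))
          1≤w/B² = ≤-trans (1≤^ (1≤log₂ n 2≤n) 4) (bound n 2+N≤n)
      in x²≤y²⇒x≤y 0≤√ (≤-resp₂ (*-identityʳ _) (trans (*-/-cancel (*-pos 0<B 0<B)) (sym √√≈w))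
           (*-monoˡ-≤ (proj₁ (*-pos 0<B 0<B)) 1≤w/B²))

    -- The scale equals k w (1 - p), where eventually k ≥ 1 and w ≥ 1, and 1 - p ≥ 1 - c. This makes
    -- 1/n negligible against it.
    scale-large : ∃ λ N → ∀ n → 2 ℕ.+ N ℕ.≤ n → 1# - c ≤ scale n
    -- √w ≥ 1 + 1/C gives both √w ≥ 1 and C√w ≥ 1; a natural number less than 1 away from C√w is
    -- then not 0.
    scale-large = let N , large = √w-large (1# + C ⁻¹) (+-pos 0<1 (proj₁ (⁻¹-pos 0<C))) in N , λ n 2+N≤n →
      let 1≤n = ℕ.≤-trans (ℕ.s≤s ℕ.z≤n) 2+N≤n
          0≤√ , √√≈w = √-spec (proj₁ (w-bounds n 1≤n))
          B≤√ = large n 2+N≤n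
          1≤√ = ≤-trans (diff⇒≤ (proj₁ (⁻¹-pos 0<C)) (solve 1 (λ x → :1 :+ x :- :1 := x) refl _)) B≤√
          1≤w = ≤-resp₂ (*-identityˡ 1#) √√≈w (*-mono-≤ 0≤1 0≤√ 1≤√ 1≤√)
          1≤C√ = ≤-trans (diff⇒≤ (proj₁ 0<C) (trans (+-congˡ (-‿cong (sym (⁻¹-inverseʳ 0<C))))
                    (solve 2 (λ C i → C :* (:1 :+ i) :- C :* i := C) refl C (C ⁻¹)))) (*-monoˡ-≤ (proj₁ 0<C) B≤√)
          1≤k = k-positive (k n) 1≤C√ (proj₂ (k≈C√w n 1≤n))
          1-c≤1-p = +-monoʳ-≤ 1# (neg-mono-≤ (p≤c n 1≤n))
      in ≤-resp₂ (trans (*-congʳ (*-identityˡ 1#)) (*-identityˡ _))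
           (trans (*-congʳ (*-congˡ (sym (np≈w n 1≤n))))
             (solve 4 (λ k N p q → k :* (N :* p) :* q := N :* k :* p :* q) refl _ _ _ _))
           (*-mono-≤ (proj₁ 0<1-c) (0≤fromℕ (k n) ⊗ ≤-trans 0≤1 1≤w)
             (*-mono-≤ 0≤1 (0≤fromℕ (k n)) 1≤k 1≤w) 1-c≤1-p)
      where
      k-positive : ∀ k {y} → 1# ≤ y → y - fromℕ k < 1# → 1# ≤ fromℕ k
      k-positive zero    1≤y y<1 = ⊥-elim (<⇒≱ y<1 (≤-respʳ-≈ (solve 1 (λ y → y := y :- :0) refl _) 1≤y))
      k-positive (suc k) 1≤y y<1 =
        diff⇒≤ (0≤fromℕ k) (solve 1 (λ k → :1 :+ k :- :1 := k) refl _)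

    Good-asymptotically : ∀ δ → 0# < δ → ∃ λ N → ∀ n → 2 ℕ.+ N ℕ.≤ n → Good n (δ * scale n)
    Good-asymptotically δ 0<δ =
      let N₁ , log⁴≤ηw = log⁴≤ η 0<η
          N₂ , 1≤√w    = √w-large 1# 0<1
      in N₁ ℕ.+ N₂ , λ n 2+N≤n → at n (ℕ.≤-trans (ℕ.m≤m+n 2 (N₁ ℕ.+ N₂)) 2+N≤n)
           (log⁴≤ηw n (ℕ.≤-trans (ℕ.+-monoʳ-≤ 2 (ℕ.m≤m+n N₁ N₂)) 2+N≤n))
           (1≤√w n (ℕ.≤-trans (ℕ.+-monoʳ-≤ 2 (ℕ.m≤n+m N₂ N₁)) 2+N≤n))
      where
      -- Half of the excess absorbs the factor 1 + 80lM, the other half pays for the union bound and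
      -- the required probability.
      h = δ * ½
      0<h = half-pos 0<δ
      -- Once √w ≥ 1, k ≤ C√w + 1 ≤ (C + 1)√w, which will be M.
      C+1 = C + 1#
      0<C+1 : 0# < C+1
      0<C+1 = +-pos 0<C 0≤1
      -- With l = b/√w the product l M is (C + 1) b, so b must meet 64(C + 1)b ≤ 1 and 80(C + 1)b ≤
      -- h. `0<fromℕ` speaks of the successor, hence 63 and 79.
      choice = ∃min (⁻¹-pos (*-pos (0<fromℕ 63) 0<C+1)) (/-pos 0<h (*-pos (0<fromℕ 79) 0<C+1))
      b = proj₁ choice
      0<b = proj₁ (proj₂ choice)
      64b≤1 : fromℕ 64 * C+1 * b ≤ 1#
      64b≤1 = ≤-respʳ-≈ (⁻¹-inverseʳ (*-pos (0<fromℕ 63) 0<C+1))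
        (*-monoˡ-≤ (proj₁ (*-pos (0<fromℕ 63) 0<C+1)) (proj₁ (proj₂ (proj₂ choice))))
      80b≤h : fromℕ 80 * C+1 * b ≤ h
      80b≤h = ≤-respʳ-≈ (*-/-cancel (*-pos (0<fromℕ 79) 0<C+1))
        (*-monoˡ-≤ (proj₁ (*-pos (0<fromℕ 79) 0<C+1)) (proj₂ (proj₂ (proj₂ choice))))
      -- As np = w and l√w = b, the gain l nkp(1 - p) h is at least k κ √w, so it remains to have 3
      -- log₂ n ≤ κ√w.
      κ = b * ((1# - c) * h)
      0<κ : 0# < κ
      0<κ = *-pos 0<b (*-pos 0<1-c 0<h)
      -- With L = log₂ n ≥ 1, this gives (3L)² ≤ 9L⁴ ≤ 9ηw = (κ√w)².
      η = κ * κ / fromℕ 9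
      0<η : 0# < η
      0<η = /-pos (*-pos 0<κ 0<κ) (0<fromℕ 8)
      at : ∀ n → 2 ℕ.≤ n → log₂ (fromℕ n) ^ 4 ≤ w n * η → 1# ≤ √ (w n) → Good n (δ * scale n)
      at n 2≤n L⁴≤ηw 1≤s = ≤-trans (+-monoʳ-≤ 1# (neg-mono-≤ tail))
        (Pr-deviation n (k n) l M T 0≤l 64lM≤1 k≤M)
        where
        open ≤R
        1≤n : 1 ℕ.≤ n
        1≤n = ℕ.≤-trans (ℕ.s≤s ℕ.z≤n) 2≤n
        open RandomGraph (p n) (proj₁ (0<p n 1≤n)) (p≤1 n 1≤n)
        N = fromℕ n
        kₙ = fromℕ (k n)
        L = log₂ N
        s = √ (w n)
        0<w = proj₁ (w-bounds n 1≤n)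
        0<s = 0<√ 0<w
        ss≈w = proj₂ (√-spec 0<w)
        M = C+1 * s
        l = b / s
        sl≈b : s * l ≈ b
        sl≈b = *-/-cancel 0<s
        lM≈ : l * M ≈ C+1 * b
        lM≈ = trans (solve 3 (λ l c s → l :* (c :* s) := c :* (s :* l)) refl l C+1 s) (*-congˡ sl≈b)
        0≤l : 0# ≤ l
        0≤l = proj₁ (/-pos 0<b 0<s)
        64lM≤1 : fromℕ 64 * (l * M) ≤ 1#
        64lM≤1 = ≤-respˡ-≈ (trans (*-assoc _ _ _) (*-congˡ (sym lM≈))) 64b≤1
        80lM≤h : fromℕ 80 * (l * M) ≤ h
        80lM≤h = ≤-respˡ-≈ (trans (*-assoc _ _ _) (*-congˡ (sym lM≈))) 80b≤h
        k≤M : kₙ ≤ M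
        k≤M = diff⇒≤ (≤⇒0≤ (proj₁ (proj₁ (k≈C√w n 1≤n))) ⊕ ≤⇒0≤ 1≤s)
          (solve 3 (λ C s k → (C :+ :1) :* s :- k := :1 :- (k :- C :* s) :+ (s :- :1)) refl C s kₙ)
        T = (N - kₙ) * kₙ * p n * (1# - p n) + δ * scale n
        0≤L : 0# ≤ L
        0≤L = ≤-trans 0≤1 (1≤log₂ n 2≤n)
        3L≤κs : fromℕ 3 * L ≤ κ * s
        3L≤κs = x²≤y²⇒x≤y (proj₁ (*-pos 0<κ 0<s)) (begin
          fromℕ 3 * L * (fromℕ 3 * L)     ≤⟨ diff⇒≤ (0≤fromℕ 9 ⊗ (0≤x² L ⊗ (≤⇒0≤ (1≤log₂ n 2≤n) ⊗ (0≤L ⊕ 0≤1))))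
                                               (solve 1 (λ L → con (ℤ.+ 9) :* (L :* (L :* (L :* (L :* :1)))) :- con (ℤ.+ 3) :* L :* (con (ℤ.+ 3) :* L)
                                                 := con (ℤ.+ 9) :* (L :* L :* ((L :- :1) :* (L :+ :1)))) refl L) ⟩
          fromℕ 9 * L ^ 4                 ≤⟨ *-monoˡ-≤ (0≤fromℕ 9) L⁴≤ηw ⟩
          fromℕ 9 * (w n * η)             ≈⟨ solve 3 (λ n w e → n :* (w :* e) := n :* e :* w) refl _ _ _ ⟩
          fromℕ 9 * η * w n               ≈⟨ *-cong (*-/-cancel (0<fromℕ 8)) (sym ss≈w) ⟩
          κ * κ * (s * s)                 ≈⟨ solve 2 (λ k s → k :* k :* (s :* s) := k :* s :* (k :* s)) refl κ s ⟩
          κ * s * (κ * s)                 ∎)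
        main : fromℕ 3 * (kₙ * L) ≤ l * (N * kₙ * p n * (1# - p n)) * h
        main = begin
          fromℕ 3 * (kₙ * L)              ≈⟨ solve 3 (λ t k L → t :* (k :* L) := k :* (t :* L)) refl _ kₙ L ⟩
          kₙ * (fromℕ 3 * L)              ≤⟨ *-monoˡ-≤ (0≤fromℕ (k n)) 3L≤κs ⟩
          kₙ * (κ * s)                    ≈⟨ solve 5 (λ k b d h s → k :* (b :* (d :* h) :* s) := k :* b :* s :* h :* d) refl kₙ b (1# - c) h s ⟩
          kₙ * b * s * h * (1# - c)       ≤⟨ *-monoˡ-≤ (0≤fromℕ (k n) ⊗ proj₁ 0<b ⊗ proj₁ 0<s ⊗ proj₁ 0<h)
                                               (+-monoʳ-≤ 1# (neg-mono-≤ (p≤c n 1≤n))) ⟩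
          kₙ * b * s * h * (1# - p n)     ≈⟨ *-congʳ (*-congʳ (*-congʳ (*-congˡ (sym sl≈b)))) ⟩
          kₙ * (s * l) * s * h * (1# - p n)
            ≈⟨ solve 5 (λ k s l h d → k :* (s :* l) :* s :* h :* d := l :* (k :* (s :* s) :* d) :* h) refl kₙ s l h (1# - p n) ⟩
          l * (kₙ * (s * s) * (1# - p n)) * h
            ≈⟨ *-congʳ (*-congˡ (*-congʳ (*-congˡ (trans ss≈w (sym (np≈w n 1≤n)))))) ⟩
          l * (kₙ * (N * p n) * (1# - p n)) * h
            ≈⟨ *-congʳ (*-congˡ (solve 4 (λ k N p q → k :* (N :* p) :* q := N :* k :* p :* q) refl _ _ _ _)) ⟩
          l * (N * kₙ * p n * (1# - p n)) * h ∎
        tail : N ^ k n * exp ((N - kₙ) * (l * (1# + fromℕ 80 * (l * M)) * kₙ * (p n * (1# - p n))) - l * T)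
          ≤ exp (- (fromℕ 2 * kₙ * L))
        tail = begin
          N ^ k n * exp E₁                ≈⟨ *-congʳ (^-congˡ (k n) (sym (exp-ln (0<n n 1≤n)))) ⟩
          exp (ln N) ^ k n * exp E₁       ≈⟨ *-congʳ (sym (exp-fromℕ-* (k n) (ln N))) ⟩
          exp (kₙ * ln N) * exp E₁        ≈⟨ sym (exp-+ _ _) ⟩
          -- δ is written as h + h, the form in which `exponent-≤` spends it.
          exp (kₙ * ln N + E₁)            ≈⟨ exp-cong (+-congˡ (+-congˡ (-‿cong (*-congˡ (+-congˡ (*-congʳ (sym (halves δ)))))))) ⟩
          exp (kₙ * ln N + _)             ≤⟨ exp-mono (exponent-≤ (ln≤log₂ n 2≤n) (0≤fromℕ (k n)) 0≤l
                                               (0≤l ⊗ (proj₁ 0<C+1 ⊗ proj₁ 0<s)) (0≤fromℕ n) (proj₁ (0<p n 1≤n)) (≤⇒0≤ (p≤1 n 1≤n)) main 80lM≤h) ⟩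
          exp (- (fromℕ 2 * kₙ * L))      ∎
          where
          E₁ = (N - kₙ) * (l * (1# + fromℕ 80 * (l * M)) * kₙ * (p n * (1# - p n))) - l * T

    -- The error term

    least-error : ∀ n → 1 ℕ.≤ n → ∃ λ s → 0# ≤ s × (∀ e → 0# ≤ e → Good n e → s ≤ e) × (∀ η → 0# < η → Good n (s + η))
    least-error n 1≤n = infimum (Good n) (Good-inhabited n 1≤n) (Good-upward n 1≤n)

    error : ℕ → ℝ
    error zero    = 0#
    error (suc n) = proj₁ (least-error (suc n) (ℕ.s≤s ℕ.z≤n)) + fromℕ (suc n) ⁻¹

    error-Good : ∀ n → 1 ℕ.≤ n → Good n (error n)
    error-Good (suc n) _ = proj₂ (proj₂ (proj₂ (least-error (suc n) (ℕ.s≤s ℕ.z≤n)))) _ (⁻¹-pos (0<fromℕ n))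

    error-nonneg : ∀ n → 0# ≤ error n
    error-nonneg zero    = ≤-refl
    error-nonneg (suc n) = proj₁ (proj₂ (least-error (suc n) (ℕ.s≤s ℕ.z≤n))) ⊕ proj₁ (⁻¹-pos (0<fromℕ n))

    error-≤ : ∀ n → 1 ℕ.≤ n → ∀ e → 0# ≤ e → Good n e → error n ≤ e + fromℕ n ⁻¹
    error-≤ (suc n) _ e 0≤e good = +-monoˡ-≤ _ (proj₁ (proj₂ (proj₂ (least-error (suc n) (ℕ.s≤s ℕ.z≤n)))) e 0≤e good)

    -- Half of ε bounds the least admissible error, by `Good-asymptotically`. The other half bounds
    -- 1/n, which is eventually at most (ε/2)(1 - c), hence at most (ε/2) `scale n`.
    error≪scale : error ≪ scale
    error≪scale = ⇝⇒⟶ λ ε 0<ε →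
      let 0<δ = half-pos 0<ε
          N₁ , good  = Good-asymptotically (ε * ½) 0<δ
          N₂ , large = scale-large
          N₃ , small = ∃⁻¹< (*-pos 0<δ 0<1-c)
      in N₁ ℕ.+ (2 ℕ.+ N₂ ℕ.+ suc N₃) ℕ.+ 2 , λ n N≤n →
        let N≤n′  = ℕ.m+n≤o⇒m≤o (N₁ ℕ.+ (2 ℕ.+ N₂ ℕ.+ suc N₃)) N≤n
            N≤n″  = ℕ.m+n≤o⇒n≤o N₁ N≤n′
            2+N₁≤n = ℕ.≤-trans (ℕ.≤-reflexive (ℕ.+-comm 2 N₁)) (ℕ.≤-trans (ℕ.+-monoˡ-≤ 2 (ℕ.m≤m+n N₁ _)) N≤n)
            2+N₂≤n = ℕ.m+n≤o⇒m≤o (2 ℕ.+ N₂) N≤n″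
            N₃<n   = ℕ.m+n≤o⇒n≤o (2 ℕ.+ N₂) N≤n″
            1≤n    = ℕ.≤-trans (ℕ.s≤s ℕ.z≤n) N₃<n
            1-c≤g  = large n 2+N₂≤n
            0<g    = <-≤-trans 0<1-c 1-c≤g
            err≤   = ≤-trans (error-≤ n 1≤n _ (proj₁ 0<δ ⊗ proj₁ 0<g) (good n 2+N₁≤n))
                       (≤-trans (+-monoʳ-≤ _ (≤-trans (small n N₃<n) (*-monoˡ-≤ (proj₁ 0<δ) 1-c≤g)))
                         (≤-reflexive (trans (sym (distribʳ _ _ _)) (trans (*-congʳ (halves ε)) (*-comm _ _)))))
        in Bd-resp (solve 1 (λ x → x := x :- :0) refl _) refl
             (Bd-weaken (≤*⇒/≤ 0<g err≤) (0≤x⇒Bd (error-nonneg n ⊗ proj₁ (⁻¹-pos 0<g))))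

theoremD1 : (em : ExcludedMiddle 0ℓ) (R : CompleteOrderedField) →
  let open Analysis em R in
  (c C : ℝ) → 0# < c → c < 1# → 0# < C →
  (w : ℕ → ℝ) →
  (∀ n → 1 ℕ.≤ n → 0# < w n × w n < c * fromℕ n) →
  (λ n → log₂ (fromℕ n) ^ 4) ≪ w →
  (k : ℕ → ℕ) →
  (∀ n → 1 ℕ.≤ n → Within 1# (fromℕ (k n)) (C * √ (w n))) →
  let p : ℕ → ℝ
      p n = w n / fromℕ n
  in
  ∃ λ (err : ℕ → ℝ) →
    (err ≪ λ n → fromℕ n * fromℕ (k n) * p n * (1# - p n)) ×
    (∀ n → 1 ℕ.≤ n →
      1# - exp (- (fromℕ 2 * fromℕ (k n) * log₂ (fromℕ n)))
        ≤ Pr n (p n) (λ G → (K : Subset n) → ∣ K ∣ ≡ k n →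
            ∑∈ (∁ K) (λ i → (fromℕ (X G K i) - fromℕ (k n) * p n) ^ 2)
              ≤ (fromℕ n - fromℕ (k n)) * fromℕ (k n) * p n * (1# - p n) + err n))
theoremD1 em R c C 0<c c<1 0<C w w-bounds log⁴≪w k k≈C√w = error , error≪scale , error-Good
  where open Proof.Asymptotics em R c C c<1 0<C w w-bounds log⁴≪w k k≈C√w
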